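{- Let $n,m$ be positive integers and $\alpha_1,\dots,\alpha_n$ the simple roots of type $A_n$. There exists a bijection $\varphi_n:\mathcal{R}^m_n\to\mathcal{P}^m_n$ such that for every $i\in\{1,\dots,n\}$ and every $R\in\mathcal{R}^m_n$, the hyperplane $H_{\alpha_i,m}$ is a separating wall of $R$ if and only if the $i$-th part of the partition $\varphi_n(R)$ equals $(n-i+1)m$.
   Context: Type $A_n$: $V=\{x\in\mathbb{R}^{n+1}:\sum x_i=0\}$ with standard inner product; positive roots $\alpha_{ij}=\varepsilon_i-\varepsilon_{j+1}$ ($1\le i\le j\le n$), simple roots $\alpha_i=\varepsilon_i-\varepsilon_{i+1}$. $H_{\alpha,k}=\{v\in V:\langle v,\alpha\rangle=k\}$. $\mathrm{Cat}^m(A_n)$ is the arrangement of the $H_{\alpha,k}$, $\alpha$ positive, $0\le k\le m$. $\mathcal{R}^m_n$ is the set of dominant regions (connected components of the complement contained in $\{v:\langle v,\alpha\rangle\ge 0\ \forall\alpha>0\}$). A separating wall of a region $R$ is a hyperplane of the arrangement supporting a facet of $R$ such that $R$ and the origin lie on different sides of it. $\mathcal{P}^m_n$ is the set of integer partitions $\lambda=(\lambda_1,\dots,\lambda_n)$ with $\lambda_1\ge\lambda_2\ge\cdots\ge\lambda_n\ge0$ and $\lambda_i\le m(n-i+1)$ for all $i$. -}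

module Defs where

open import Algebra.Apartness.Bundles using (HeytingField; HeytingCommutativeRing)
open import Algebra.Bundles using (CommutativeRing; Semiring)
import Algebra.Definitions.RawSemiring as RawSemiringDefs
import Algebra.Properties.Semiring.Sum as SemiringSum
open import Data.Bool.Base using (if_then_else_)
open import Data.Fin.Base as Fin using (Fin; inject₁; toℕ)
import Data.Fin.Properties as Fin
open import Data.Nat.Base as ℕ using (ℕ; suc; _∸_)
open import Data.Product.Base using (_×_; ∃-syntax; Σ-syntax)
open import Data.Sum.Base using (_⊎_)
open import Data.Vec.Functional using (Vector; replicate)
open import Level using (0ℓ) renaming (suc to lsuc)
open import Relation.Binary.Bundles using (Setoid)
import Relation.Binary.Construct.On as On
open import Relation.Binary.Core using (Rel)
open import Relation.Binary.PropositionalEquality using (_→-setoid_)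
open import Relation.Binary.Structures using (IsStrictPartialOrder)
open import Relation.Nullary.Decidable.Core using (does)
open import Relation.Nullary.Negation.Core using (¬_)
open import Relation.Unary using (Pred; _∈_; _⊆_; _∩_; _∪_; _≐_; Satisfiable)
open import Relation.Unary.Relation.Binary.Equality using (≐-setoid)

-- The real numbers, axiomatised as a Cauchy complete Archimedean ordered field.
-- The order is in positive form: apartness x # y is the disjunction of x < y
-- and y < x, while ≈ is its negation (tightness, part of HeytingField).  With
-- excluded middle these are the usual axioms, determining ℝ up to isomorphism.
record RealNumbers : Set₁ where
  field
    heytingField : HeytingField 0ℓ 0ℓ 0ℓ

  open HeytingField heytingField public

  infix 4 _<_ _≤_

  field
    _<_                  : Rel Carrier 0ℓ
    isStrictPartialOrder : IsStrictPartialOrder _≈_ _<_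
    #⇒<⊎>                : ∀ {x y} → x # y → x < y ⊎ y < x
    <⇒#                  : ∀ {x y} → x < y → x # y
    +-monoʳ-<            : ∀ x {y z} → y < z → x + y < x + z
    *-pos                : ∀ {x y} → 0# < x → 0# < y → 0# < x * y

  open CommutativeRing (HeytingCommutativeRing.commutativeRing heytingCommutativeRing) public
    using (semiring)
  open RawSemiringDefs (Semiring.rawSemiring semiring) public using (sum) renaming (_×_ to _·_)

  fromℕ : ℕ → Carrier
  fromℕ k = k · 1#

  _≤_ : Rel Carrier 0ℓ
  x ≤ y = ¬ (y < x)

  -- |x − y| < δ
  Within : Carrier → Rel Carrier 0ℓ
  Within δ x y = (x < y + δ) × (y < x + δ)

  IsCauchy : (ℕ → Carrier) → Set
  IsCauchy s = ∀ δ → 0# < δ → ∃[ N ] (∀ p q → N ℕ.≤ p → N ℕ.≤ q → Within δ (s p) (s q))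

  _ConvergesTo_ : (ℕ → Carrier) → Carrier → Set
  s ConvergesTo l = ∀ δ → 0# < δ → ∃[ N ] (∀ p → N ℕ.≤ p → Within δ (s p) l)

  field
    archimedean : ∀ x → ∃[ k ] x < fromℕ k
    complete    : ∀ s → IsCauchy s → ∃[ l ] s ConvergesTo l

module TypeA (ℝ : RealNumbers) (n : ℕ) where

  open RealNumbers ℝ
  open SemiringSum semiring using (sum-replicate-zero)

  ⟨_,_⟩ : Vector Carrier (suc n) → Vector Carrier (suc n) → Carrier
  ⟨ x , y ⟩ = sum (λ i → x i * y i)

  record V : Set where
    constructor mkV
    field
      coord : Vector Carrier (suc n)
      sum≈0 : sum coord ≈ 0#

  open V public

  ε : Fin (suc n) → Vector Carrier (suc n)
  ε i j = if does (i Fin.≟ j) then 1# else 0#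

  record PositiveRoot : Set where
    constructor mkRoot
    field
      i j : Fin n
      i≤j : i Fin.≤ j

  -- ε_i − ε_{j+1}; the indices of simple roots are 0-based here.
  root : PositiveRoot → Vector Carrier (suc n)
  root (mkRoot i j _) k = ε (inject₁ i) k - ε (Fin.suc j) k

  simple : Fin n → PositiveRoot
  simple i = mkRoot i i Fin.≤-refl

  pairing : V → PositiveRoot → Carrier
  pairing v α = ⟨ coord v , root α ⟩

  H : PositiveRoot → ℕ → Pred V 0ℓ
  H α k v = pairing v α ≈ fromℕ k

  Below Above : PositiveRoot → ℕ → Pred V 0ℓ
  Below α k v = pairing v α < fromℕ k
  Above α k v = fromℕ k < pairing v α

  AtMost AtLeast : PositiveRoot → ℕ → Pred V 0ℓ
  AtMost  α k v = pairing v α ≤ fromℕ k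
  AtLeast α k v = fromℕ k ≤ pairing v α

  origin : V
  origin = mkV (replicate (suc n) 0#) (sum-replicate-zero (suc n))

  -- Sup-norm balls; they generate the Euclidean topology of V.
  Ball : V → Carrier → Pred V 0ℓ
  Ball x δ y = ∀ i → Within δ (coord x i) (coord y i)

  IsOpen : Pred V 0ℓ → Set
  IsOpen U = ∀ {x} → x ∈ U → ∃[ δ ] (0# < δ × Ball x δ ⊆ U)

  closure : Pred V 0ℓ → Pred V 0ℓ
  closure S x = ∀ δ → 0# < δ → Satisfiable (S ∩ Ball x δ)

  -- Two open sets that cover C and both meet C must meet inside C: positive
  -- form of "C is not split by two disjoint nonempty relatively open sets".
  IsConnected : Pred V 0ℓ → Set₁
  IsConnected C = ∀ (U W : Pred V 0ℓ) → IsOpen U → IsOpen W → C ⊆ U ∪ W →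
    Satisfiable (C ∩ U) → Satisfiable (C ∩ W) → Satisfiable (C ∩ (U ∩ W))

  record IsConnectedComponent (A C : Pred V 0ℓ) : Set₁ where
    field
      nonempty  : Satisfiable C
      contained : C ⊆ A
      connected : IsConnected C
      maximal   : ∀ (D : Pred V 0ℓ) → D ⊆ A → IsConnected D → C ⊆ D → D ⊆ C

  affineHull : Pred V 0ℓ → Pred V 0ℓ
  affineHull S v =
    ∃[ k ] Σ[ p ∈ Vector V k ] Σ[ c ∈ Vector Carrier k ]
      (∀ a → p a ∈ S) × (sum c ≈ 1#) ×
      (∀ i → coord v i ≈ sum (λ a → c a * coord (p a) i))

  -- H α k is a supporting hyperplane of the closed region, and the face it cuts
  -- out has codimension one, i.e. its affine hull is the whole of H α k.
  SupportsFacet : PositiveRoot → ℕ → Pred V 0ℓ → Set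
  SupportsFacet α k R =
    (closure R ⊆ AtMost α k ⊎ closure R ⊆ AtLeast α k) ×
    (affineHull (closure R ∩ H α k) ≐ H α k)

  SeparatesFromOrigin : PositiveRoot → ℕ → Pred V 0ℓ → Set
  SeparatesFromOrigin α k R =
    (R ⊆ Above α k × origin ∈ Below α k) ⊎ (R ⊆ Below α k × origin ∈ Above α k)

  dominantCone : Pred V 0ℓ
  dominantCone v = ∀ α → 0# ≤ pairing v α

module Catalan (ℝ : RealNumbers) (n m : ℕ) where

  open RealNumbers ℝ
  open TypeA ℝ n public

  -- Lying off a hyperplane is expressed by apartness, the positive form of ≉.
  complement : Pred V 0ℓ
  complement v = ∀ α k → k ℕ.≤ m → pairing v α # fromℕ k

  record DominantRegion : Set₁ where
    field
      points      : Pred V 0ℓ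
      isComponent : IsConnectedComponent complement points
      dominant    : points ⊆ dominantCone

  open DominantRegion public

  𝓡 : Setoid (lsuc 0ℓ) 0ℓ
  𝓡 = On.setoid (≐-setoid V 0ℓ) points

  IsSeparatingWall : PositiveRoot → ℕ → DominantRegion → Set
  IsSeparatingWall α k R =
    k ℕ.≤ m × SupportsFacet α k (points R) × SeparatesFromOrigin α k (points R)

-- Parts are indexed from 0, so n − i + 1 in 1-based indexing is n ∸ toℕ i.
record Partition (n m : ℕ) : Set where
  field
    part       : Fin n → ℕ
    decreasing : ∀ i j → i Fin.≤ j → part j ℕ.≤ part i
    bounded    : ∀ i → part i ℕ.≤ m ℕ.* (n ∸ toℕ i)

open Partition public

𝓟 : ℕ → ℕ → Setoid 0ℓ 0ℓ
𝓟 n m = On.setoid (Fin n →-setoid ℕ) (part {n} {m})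

{-# OPTIONS --safe #-}

-- A dominant region is convex, hence it is the cell of all points v with a common address
-- K(α) = min(m, ⌊⟨v, α⟩⌋); connectedness of a convex cell is proved by bisection.  The bijection
-- sends a region to its row sums λ_i = Σ_j K(α_ij).
--
-- Injectivity: let rows i + 1, …, n agree for x and y.  If row i differs although its sum does not,
-- then K goes up at some α_ij and down at some α_ij′, say from below c to c and from c′ to below c′.
-- Then x and y lie on different sides of the value c − c′ for the coordinate difference
-- x_{j′+1} − x_{j+1}, which is up to sign a root in a lower row, a contradiction.
--
-- Surjectivity: points are added at the top of a configuration on the line, in integer coordinates
-- in which all existing points are pairwise incongruent modulo the unit.  As the new point moves up
-- its row sum grows in steps of at most 1, so it attains every admissible value.
--
-- Walls: a full row means K(α_i) = m.  A point of such a cell can be moved down along the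
-- fundamental coweight of α_i onto the hyperplane of level m without meeting any other hyperplane.
module Submission where

open import Defs
open import Algebra.Apartness.Bundles using (HeytingCommutativeRing)
import Algebra.Apartness.Properties.HeytingCommutativeRing as HeytingProperties
open import Algebra.Bundles using (CommutativeRing)
import Algebra.Properties.Ring as RingProperties
import Algebra.Properties.Semiring.Mult as SemiringMult
import Algebra.Properties.Semiring.Mult.TCOptimised as SemiringMult′
import Algebra.Properties.Semiring.Sum as SemiringSum
import Algebra.Solver.Ring as RingSolver
open import Algebra.Solver.Ring.AlmostCommutativeRing using (AlmostCommutativeRing; fromCommutativeRing; _-Raw-AlmostCommutative⟶_)
open import Data.Bool.Base using (if_then_else_)
open import Data.Empty using (⊥)
open import Data.Fin.Base as Fin using (Fin; toℕ; inject₁)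
import Data.Fin.Induction as Fin
import Data.Fin.Properties as Fin
open import Data.Integer.Base as ℤ using (ℤ; +_; -[1+_]; _⊖_)
import Data.Integer.Properties as ℤ
open import Data.Maybe.Base using (just; nothing)
open import Data.Nat.Base as ℕ using (ℕ; zero; suc)
open import Data.Nat.DivMod using (/-congˡ; /-monoˡ-≤; m*n/n≡m; m*n/m*o≡n/o; m/n*n≤m; m<n*o⇒m/o<n; 0/n≡0)
open import Data.Nat.Divisibility using (_∣_; divides; ∣m+n∣m⇒∣n; *-cancelˡ-∣; ∣-trans; m∣m*n; ∣1⇒≡1)
import Data.Nat.Properties as ℕ
open import Data.Product.Base using (Σ-syntax; ∃-syntax; _×_; _,_; proj₁; proj₂)
import Data.Sign.Base as Sign
open import Data.Sum.Base using (_⊎_; inj₁; inj₂; [_,_]′)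
open import Data.Vec.Functional using (Vector)
open import Function.Base using (_∘_)
open import Function.Bundles using (Bijection; _⇔_; mk⇔)
open import Induction.WellFounded using (Acc; acc)
open import Level using (0ℓ)
open import Relation.Binary.Definitions using (WeaklyDecidable; Tri; tri<; tri≈; tri>)
open import Relation.Binary.PropositionalEquality as ≡ using (_≡_)
import Relation.Binary.Reasoning.Setoid as ≈-Reasoning
open import Relation.Binary.Structures using (IsStrictPartialOrder)
open import Relation.Nullary using (¬_; Dec; does; yes; no; contradiction)
open import Relation.Unary using (Pred; _∈_; _⊆_; _∩_; _≐_; Satisfiable)

-- Ring solver with integer coefficients over a commutative ring.

module IntegerCoefficients (R : CommutativeRing 0ℓ 0ℓ) where

  open CommutativeRing R
  open RingProperties ring
  open SemiringMult′ semiring renaming (_×_ to _·′_)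
  open ≈-Reasoning setoid

  -- The optimised multiple `_·′_` evaluates 0 and 1 definitionally to `0#` and `1#`, so solver
  -- constants match goals written with `0#` and `1#`.
  ⟦_⟧ℤ : ℤ → Carrier
  ⟦ + k ⟧ℤ      = k ·′ 1#
  ⟦ -[1+ k ] ⟧ℤ = - (suc k ·′ 1#)

  ⟦⟧-neg : ∀ k → ⟦ ℤ.- (+ k) ⟧ℤ ≈ - (k ·′ 1#)
  ⟦⟧-neg zero    = sym -0#≈0#
  ⟦⟧-neg (suc k) = refl

  private
    cancel : ∀ a x y → (a + x) - (a + y) ≈ x - y
    cancel a x y = begin
      (a + x) - (a + y)       ≈⟨ +-congˡ (-‿+-comm a y) ⟨
      (a + x) + (- a - y)     ≈⟨ +-congʳ (+-comm a x) ⟩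
      (x + a) + (- a - y)     ≈⟨ +-assoc x a _ ⟩
      x + (a + (- a - y))     ≈⟨ +-congˡ (+-assoc a _ _) ⟨
      x + ((a - a) - y)       ≈⟨ +-congˡ (+-congʳ (-‿inverseʳ a)) ⟩
      x + (0# - y)            ≈⟨ +-congˡ (+-identityˡ _) ⟩
      x - y                   ∎

  ⟦⟧-⊖ : ∀ j k → ⟦ j ⊖ k ⟧ℤ ≈ j ·′ 1# - k ·′ 1#
  ⟦⟧-⊖ j       zero    = sym (trans (+-congˡ -0#≈0#) (+-identityʳ _))
  ⟦⟧-⊖ zero    (suc k) = sym (+-identityˡ _)
  ⟦⟧-⊖ (suc j) (suc k) = begin
    ⟦ suc j ⊖ suc k ⟧ℤ               ≡⟨ ≡.cong ⟦_⟧ℤ (ℤ.[1+m]⊖[1+n]≡m⊖n j k) ⟩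
    ⟦ j ⊖ k ⟧ℤ                       ≈⟨ ⟦⟧-⊖ j k ⟩
    j ·′ 1# - k ·′ 1#                ≈⟨ cancel 1# _ _ ⟨
    (1# + j ·′ 1#) - (1# + k ·′ 1#)  ≈⟨ +-cong (1+× j 1#) (-‿cong (1+× k 1#)) ⟨
    suc j ·′ 1# - suc k ·′ 1#        ∎

  ⟦⟧-+ : ∀ a b → ⟦ a ℤ.+ b ⟧ℤ ≈ ⟦ a ⟧ℤ + ⟦ b ⟧ℤ
  ⟦⟧-+ (+ j)    (+ k)    = ×-homo-+ 1# j k
  ⟦⟧-+ (+ j)    -[1+ k ] = ⟦⟧-⊖ j (suc k)
  ⟦⟧-+ -[1+ j ] (+ k)    = trans (⟦⟧-⊖ k (suc j)) (+-comm _ _)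
  ⟦⟧-+ -[1+ j ] -[1+ k ] = begin
    - (suc (suc (j ℕ.+ k)) ·′ 1#)        ≡⟨ ≡.cong (λ l → - (suc l ·′ 1#)) (≡.sym (ℕ.+-suc j k)) ⟩
    - ((suc j ℕ.+ suc k) ·′ 1#)          ≈⟨ -‿cong (×-homo-+ 1# (suc j) (suc k)) ⟩
    - (suc j ·′ 1# + suc k ·′ 1#)        ≈⟨ -‿+-comm _ _ ⟨
    - (suc j ·′ 1#) - (suc k ·′ 1#)      ∎

  ⟦⟧-- : ∀ a → ⟦ ℤ.- a ⟧ℤ ≈ - ⟦ a ⟧ℤ
  ⟦⟧-- (+ k)    = ⟦⟧-neg k
  ⟦⟧-- -[1+ k ] = sym (-‿involutive _)

  ⟦⟧-* : ∀ a b → ⟦ a ℤ.* b ⟧ℤ ≈ ⟦ a ⟧ℤ * ⟦ b ⟧ℤ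
  ⟦⟧-* (+ j)    (+ k)    = trans (reflexive (≡.cong ⟦_⟧ℤ (ℤ.+◃n≡+n (j ℕ.* k)))) (×1-homo-* j k)
  ⟦⟧-* (+ j)    -[1+ k ] = begin
    ⟦ Sign.- ℤ.◃ (j ℕ.* suc k) ⟧ℤ  ≡⟨ ≡.cong ⟦_⟧ℤ (ℤ.-◃n≡-n (j ℕ.* suc k)) ⟩
    ⟦ ℤ.- (+ (j ℕ.* suc k)) ⟧ℤ     ≈⟨ ⟦⟧-neg (j ℕ.* suc k) ⟩
    - ((j ℕ.* suc k) ·′ 1#)        ≈⟨ -‿cong (×1-homo-* j (suc k)) ⟩
    - (j ·′ 1# * suc k ·′ 1#)      ≈⟨ -‿distribʳ-* _ _ ⟩
    j ·′ 1# * - (suc k ·′ 1#)      ∎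
  ⟦⟧-* -[1+ j ] (+ k)    = begin
    ⟦ Sign.- ℤ.◃ (suc j ℕ.* k) ⟧ℤ  ≡⟨ ≡.cong ⟦_⟧ℤ (ℤ.-◃n≡-n (suc j ℕ.* k)) ⟩
    ⟦ ℤ.- (+ (suc j ℕ.* k)) ⟧ℤ     ≈⟨ ⟦⟧-neg (suc j ℕ.* k) ⟩
    - ((suc j ℕ.* k) ·′ 1#)        ≈⟨ -‿cong (×1-homo-* (suc j) k) ⟩
    - (suc j ·′ 1# * k ·′ 1#)      ≈⟨ -‿distribˡ-* _ _ ⟩
    - (suc j ·′ 1#) * k ·′ 1#      ∎
  ⟦⟧-* -[1+ j ] -[1+ k ] = begin
    (suc j ℕ.* suc k) ·′ 1#            ≈⟨ ×1-homo-* (suc j) (suc k) ⟩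
    suc j ·′ 1# * suc k ·′ 1#          ≈⟨ -‿involutive _ ⟨
    - - (suc j ·′ 1# * suc k ·′ 1#)    ≈⟨ -‿cong (-‿distribˡ-* _ _) ⟩
    - (- (suc j ·′ 1#) * suc k ·′ 1#)  ≈⟨ -‿distribʳ-* _ _ ⟩
    - (suc j ·′ 1#) * - (suc k ·′ 1#)  ∎

  almostCommutativeRing : AlmostCommutativeRing 0ℓ 0ℓ
  almostCommutativeRing = fromCommutativeRing R

  morphism : ℤ.+-*-rawRing -Raw-AlmostCommutative⟶ almostCommutativeRing
  morphism = record
    { ⟦_⟧    = ⟦_⟧ℤ
    ; +-homo = ⟦⟧-+
    ; *-homo = ⟦⟧-*
    ; -‿homo = ⟦⟧--
    ; 0-homo = refl
    ; 1-homo = refl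
    }

  _≟ᶜ_ : WeaklyDecidable (λ a b → ⟦ a ⟧ℤ ≈ ⟦ b ⟧ℤ)
  a ≟ᶜ b with a ℤ.≟ b
  ... | yes eq = just (reflexive (≡.cong ⟦_⟧ℤ eq))
  ... | no  _  = nothing

  open RingSolver ℤ.+-*-rawRing almostCommutativeRing morphism _≟ᶜ_ public
    using (solve; _:=_; _:+_; _:*_; _:-_; :-_; con)

-- Order, inverses and small quantities in the real field.

module OrderedField (ℝ : RealNumbers) where

  open RealNumbers ℝ hiding (zero)
  open HeytingProperties heytingCommutativeRing using (1#0)
  open IntegerCoefficients (HeytingCommutativeRing.commutativeRing heytingCommutativeRing) public
    using (solve; _:=_; _:+_; _:*_; _:-_; :-_; con)
  open IsStrictPartialOrder isStrictPartialOrder public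
    using () renaming (irrefl to <-irrefl; trans to <-trans; <-respˡ-≈ to <-respˡ; <-respʳ-≈ to <-respʳ)
  open SemiringMult semiring using (×-homo-+; ×1-homo-*)
  open ≈-Reasoning setoid

  positive-difference : ∀ {x y} → x < y → 0# < y - x
  positive-difference {x} {y} x<y =
    <-respˡ (-‿inverseˡ x) (<-respʳ (+-comm (- x) y) (+-monoʳ-< (- x) x<y))

  -- The usual route to an inequality: assemble a positive quantity `e` and let the ring solver
  -- identify it with `y - x`.
  <-from : ∀ {e x y} → 0# < e → e ≈ y - x → x < y
  <-from {e} {x} {y} 0<e eq = <-respˡ (+-identityʳ x) (<-respʳ x+e≈y (+-monoʳ-< x 0<e))
    where
    x+e≈y : x + e ≈ y
    x+e≈y = trans (+-congˡ eq) (solve 2 (λ a b → a :+ (b :- a) := b) refl x y)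

  pos : ∀ {e x} → 0# < e → e ≈ x → 0# < x
  pos 0<e eq = <-respʳ eq 0<e

  <-asym : ∀ {x y} → x < y → y < x → ∀ {a} {A : Set a} → A
  <-asym x<y y<x = contradiction (<-trans x<y y<x) (<-irrefl refl)

  <⇒≤ : ∀ {x y} → x < y → x ≤ y
  <⇒≤ x<y y<x = <-asym x<y y<x

  ≈⇒≤ : ∀ {x y} → x ≈ y → x ≤ y
  ≈⇒≤ x≈y = <-irrefl (sym x≈y)

  ≤-refl : ∀ {x} → x ≤ x
  ≤-refl = ≈⇒≤ refl

  -- Cotransitivity of apartness, refined by the order. It serves as the constructive substitute for
  -- trichotomy.
  <-cotrans : ∀ {x y} → x < y → ∀ z → x < z ⊎ z < y
  <-cotrans x<y z with #-cotrans (<⇒# x<y) z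
  ... | inj₁ x#z with #⇒<⊎> x#z
  ...   | inj₁ x<z = inj₁ x<z
  ...   | inj₂ z<x = inj₂ (<-trans z<x x<y)
  <-cotrans x<y z | inj₂ z#y with #⇒<⊎> z#y
  ...   | inj₁ z<y = inj₂ z<y
  ...   | inj₂ y<z = inj₁ (<-trans x<y y<z)

  <-≤-trans : ∀ {x y z} → x < y → y ≤ z → x < z
  <-≤-trans {z = z} x<y y≤z with <-cotrans x<y z
  ... | inj₁ x<z = x<z
  ... | inj₂ z<y = contradiction z<y y≤z

  ≤-<-trans : ∀ {x y z} → x ≤ y → y < z → x < z
  ≤-<-trans {x} x≤y y<z with <-cotrans y<z x
  ... | inj₁ y<x = contradiction y<x x≤y
  ... | inj₂ x<z = x<z

  ≤-trans : ∀ {x y z} → x ≤ y → y ≤ z → x ≤ z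
  ≤-trans x≤y y≤z z<x = x≤y (≤-<-trans y≤z z<x)

  nonneg-difference : ∀ {x y} → x ≤ y → 0# ≤ y - x
  nonneg-difference {x} {y} x≤y y-x<0 = x≤y (<-from (positive-difference y-x<0)
    (solve 2 (λ a b → con (+ 0) :- (b :- a) := a :- b) refl x y))

  ≤-from : ∀ {e x y} → 0# ≤ e → e ≈ y - x → x ≤ y
  ≤-from {e} {x} {y} 0≤e eq y<x = 0≤e (<-respˡ (sym eq) (<-from (positive-difference y<x)
    (solve 2 (λ a b → a :- b := con (+ 0) :- (b :- a)) refl x y)))

  +-pos : ∀ {x y} → 0# < x → 0# < y → 0# < x + y
  +-pos {x} 0<x 0<y = <-trans 0<x (<-respˡ (+-identityʳ x) (+-monoʳ-< x 0<y))

  +-pos-nonneg : ∀ {x y} → 0# < x → 0# ≤ y → 0# < x + y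
  +-pos-nonneg {x} {y} 0<x 0≤y = <-≤-trans 0<x
    (≤-from 0≤y (solve 2 (λ a b → b := (a :+ b) :- a) refl x y))

  +-nonneg : ∀ {x y} → 0# ≤ x → 0# ≤ y → 0# ≤ x + y
  +-nonneg {x} {y} 0≤x 0≤y = ≤-trans 0≤x
    (≤-from 0≤y (solve 2 (λ a b → b := (a :+ b) :- a) refl x y))

  -- The signs of `x` and `y` cannot be decided, so tightness is used: given `x * y < 0#`, if `x`
  -- were apart from zero it would be positive, which forces `y ≈ 0#` and a zero product. Hence
  -- `x ≈ 0#`, and the product is zero anyway.
  *-nonneg : ∀ {x y} → 0# ≤ x → 0# ≤ y → 0# ≤ x * y
  *-nonneg {x} {y} 0≤x 0≤y xy<0 = <-irrefl (trans (*-congʳ x≈0) (zeroˡ y)) xy<0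
    where
    nonneg⇒pos : ∀ {z} → 0# ≤ z → z # 0# → 0# < z
    nonneg⇒pos 0≤z z#0 with #⇒<⊎> z#0
    ... | inj₁ z<0 = contradiction z<0 0≤z
    ... | inj₂ 0<z = 0<z
    x≈0 : x ≈ 0#
    x≈0 = proj₁ (tight x 0#) λ x#0 →
      let y≈0 = proj₁ (tight y 0#) λ y#0 →
            <-asym (*-pos (nonneg⇒pos 0≤x x#0) (nonneg⇒pos 0≤y y#0)) xy<0
      in <-irrefl (trans (*-congˡ y≈0) (zeroʳ x)) xy<0

  -- If `1#` were negative, its negative would be positive with square `1#`.
  0<1 : 0# < 1#
  0<1 with #⇒<⊎> 1#0
  ... | inj₂ 0<1 = 0<1
  ... | inj₁ 1<0 = <-asym 1<0 (pos (*-pos 0<-1 0<-1)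
      (solve 0 ((con (+ 0) :- con (+ 1)) :* (con (+ 0) :- con (+ 1)) := con (+ 1)) refl))
    where
    0<-1 : 0# < 0# - 1#
    0<-1 = positive-difference 1<0

  pos-inverse : ∀ {x} → 0# < x → ∃[ y ] 0# < y × x * y ≈ 1#
  pos-inverse {x} 0<x with #⇒invertible (<⇒# 0<x)
  -- The field axiom inverts the difference `0# - x`, so the inverse of `x` is the negative of `y`.
  ... | (y , _ , eq) = - y , 0<-y , x*-y≈1
    where
    x*-y≈1 : x * - y ≈ 1#
    x*-y≈1 = trans (solve 2 (λ a b → a :* (:- b) := (con (+ 0) :- a) :* b) refl x y) eq
    x*[-y-0]≈1 : x * (- y - 0#) ≈ 1#
    x*[-y-0]≈1 = trans (solve 2 (λ a b → a :* (:- b :- con (+ 0)) := a :* (:- b)) refl x y) x*-y≈1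
    -y#0 : - y # 0#
    -y#0 = invertible⇒# (x , x*[-y-0]≈1 , trans (*-comm _ _) x*[-y-0]≈1)
    1+x*y≈0 : x * (0# - - y) ≈ 0# - 1#
    1+x*y≈0 = begin
      x * (0# - - y)  ≈⟨ solve 2 (λ a b → a :* (con (+ 0) :- (:- b)) := con (+ 0) :- (a :* (:- b))) refl x y ⟩
      0# - x * - y    ≈⟨ +-congˡ (-‿cong x*-y≈1) ⟩
      0# - 1#         ∎
    0<-y : 0# < - y
    0<-y = [ (λ -y<0 → <-asym 0<1 (<-from (*-pos 0<x (positive-difference -y<0)) 1+x*y≈0)) , (λ 0<-y → 0<-y) ]′ (#⇒<⊎> -y#0)

  pos-cancelˡ : ∀ {c x} → 0# < c → 0# < c * x → 0# < x
  pos-cancelˡ {c} {x} 0<c 0<cx with pos-inverse 0<c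
  ... | (y , 0<y , cy≈1) = pos (*-pos 0<y 0<cx) (begin
    y * (c * x)  ≈⟨ solve 3 (λ y c x → y :* (c :* x) := (c :* y) :* x) refl y c x ⟩
    (c * y) * x  ≈⟨ *-congʳ cy≈1 ⟩
    1# * x       ≈⟨ *-identityˡ x ⟩
    x            ∎)

  fromℕ-+ : ∀ j k → fromℕ (j ℕ.+ k) ≈ fromℕ j + fromℕ k
  fromℕ-+ = ×-homo-+ 1#

  fromℕ-* : ∀ j k → fromℕ (j ℕ.* k) ≈ fromℕ j * fromℕ k
  fromℕ-* = ×1-homo-*

  0≤fromℕ : ∀ k → 0# ≤ fromℕ k
  0≤fromℕ zero    = ≤-refl
  0≤fromℕ (suc k) = +-nonneg (<⇒≤ 0<1) (0≤fromℕ k)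

  0<fromℕ : ∀ k → 0# < fromℕ (suc k)
  0<fromℕ k = +-pos-nonneg 0<1 (0≤fromℕ k)

  fromℕ-∸ : ∀ {j k} → j ℕ.≤ k → fromℕ (k ℕ.∸ j) ≈ fromℕ k - fromℕ j
  fromℕ-∸ {j} {k} j≤k = begin
    fromℕ (k ℕ.∸ j)                        ≈⟨ solve 2 (λ a b → b := (a :+ b) :- a) refl (fromℕ j) _ ⟩
    (fromℕ j + fromℕ (k ℕ.∸ j)) - fromℕ j  ≈⟨ +-congʳ (fromℕ-+ j _) ⟨
    fromℕ (j ℕ.+ (k ℕ.∸ j)) - fromℕ j      ≡⟨ ≡.cong (λ l → fromℕ l - fromℕ j) (ℕ.m+[n∸m]≡n j≤k) ⟩
    fromℕ k - fromℕ j                      ∎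

  fromℕ-mono-≤ : ∀ {j k} → j ℕ.≤ k → fromℕ j ≤ fromℕ k
  fromℕ-mono-≤ {j} {k} j≤k = ≤-from (0≤fromℕ (k ℕ.∸ j)) (fromℕ-∸ j≤k)

  fromℕ-mono-< : ∀ {j k} → j ℕ.< k → fromℕ j < fromℕ k
  fromℕ-mono-< {j} {suc k} (ℕ.s≤s j≤k) = ≤-<-trans (fromℕ-mono-≤ j≤k)
    (<-from 0<1 (solve 1 (λ a → con (+ 1) := (con (+ 1) :+ a) :- a) refl (fromℕ k)))

  fromℕ-cancel-< : ∀ {j k} → fromℕ j < fromℕ k → j ℕ.< k
  fromℕ-cancel-< {j} {k} j<k with k ℕ.≤? j
  ... | yes k≤j = contradiction j<k (fromℕ-mono-≤ k≤j)
  ... | no  k≰j = ℕ.≰⇒> k≰j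

  opaque
    -- The reciprocal of `k + 1`, a null sequence that supplies all small positive parameters below.
    inv : ℕ → Carrier
    inv k = proj₁ (pos-inverse (0<fromℕ k))

    0<inv : ∀ k → 0# < inv k
    0<inv k = proj₁ (proj₂ (pos-inverse (0<fromℕ k)))

    fromℕ*inv : ∀ k → fromℕ (suc k) * inv k ≈ 1#
    fromℕ*inv k = proj₂ (proj₂ (pos-inverse (0<fromℕ k)))

  inv≤1 : ∀ k → inv k ≤ 1#
  inv≤1 k = ≤-from (*-nonneg (0≤fromℕ k) (<⇒≤ (0<inv k))) (begin
    fromℕ k * inv k                  ≈⟨ solve 2 (λ F i → F :* i := ((con (+ 1) :+ F) :* i) :- i) refl (fromℕ k) (inv k) ⟩
    fromℕ (suc k) * inv k - inv k    ≈⟨ +-congʳ (fromℕ*inv k) ⟩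
    1# - inv k                       ∎)

  ½ : Carrier
  ½ = inv 1

  ½+½ : ½ + ½ ≈ 1#
  ½+½ = trans (solve 1 (λ h → h :+ h := (con (+ 1) :+ (con (+ 1) :+ con (+ 0))) :* h) refl ½) (fromℕ*inv 1)

  -- Lets finitely many strict inequalities be met at one common small parameter `inv k`.
  Eventually : (ℕ → Set) → Set
  Eventually P = ∃[ N ] (∀ k → N ℕ.≤ k → P k)

  Eventually-zip : ∀ {P Q R : ℕ → Set} → (∀ {k} → P k → Q k → R k) →
    Eventually P → Eventually Q → Eventually R
  Eventually-zip f (M , p) (N , q) = M ℕ.⊔ N , λ k M⊔N≤k →
    f (p k (ℕ.≤-trans (ℕ.m≤m⊔n M N) M⊔N≤k)) (q k (ℕ.≤-trans (ℕ.m≤n⊔m M N) M⊔N≤k))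

  Eventually-∀ : ∀ {n} {P : Fin n → ℕ → Set} →
    (∀ i → Eventually (P i)) → Eventually (λ k → ∀ i → P i k)
  Eventually-∀ {zero}  ev = 0 , λ _ _ ()
  Eventually-∀ {suc n} ev = Eventually-zip (λ { p q Fin.zero → p ; p q (Fin.suc i) → q i })
    (ev Fin.zero) (Eventually-∀ (ev ∘ Fin.suc))

  Eventually-const : ∀ {P : ℕ → Set} → (∀ k → P k) → Eventually P
  Eventually-const p = 0 , λ k _ → p k

  -- After multiplication by `k + 1` and division by `b - a`, the claim is that `k + 1` exceeds
  -- `- (c * y)` with `y` the inverse of `b - a`; this is the Archimedean axiom.
  eventually-< : ∀ {a b} c → a < b → Eventually (λ k → a < b + inv k * c)
  eventually-< {a} {b} c a<b with pos-inverse (positive-difference a<b)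
  ... | (y , _ , ey≈1) with archimedean (- (c * y))
  ...   | (N , -cy<N) = N , λ k N≤k →
    let large = <-≤-trans -cy<N (≤-trans (fromℕ-mono-≤ N≤k) (fromℕ-mono-≤ (ℕ.n≤1+n k)))
    in <-from (*-pos (*-pos (0<inv k) (positive-difference a<b)) (positive-difference large)) (begin
      inv k * (b - a) * (fromℕ (suc k) - - (c * y))
        ≈⟨ solve 5 (λ i e F c y → i :* e :* (F :- (:- (c :* y))) := e :* (F :* i) :+ (i :* c) :* (e :* y))
             refl (inv k) (b - a) (fromℕ (suc k)) c y ⟩
      (b - a) * (fromℕ (suc k) * inv k) + inv k * c * ((b - a) * y)
        ≈⟨ +-cong (*-congˡ (fromℕ*inv k)) (*-congˡ ey≈1) ⟩
      (b - a) * 1# + inv k * c * 1#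
        ≈⟨ solve 3 (λ a b d → (b :- a) :* con (+ 1) :+ d :* con (+ 1) := (b :+ d) :- a) refl a b (inv k * c) ⟩
      b + inv k * c - a ∎)

  -- The expression `δ + s * d` is affine in `s` and positive at both ends of the interval from
  -- `- η` to `η`. Up to the factor `η + η` it is the combination of the end values with the
  -- positive weights `η - s` and `s + η`.
  product-< : ∀ {η s d δ} → 0# < η → - η < s → s < η → 0# < δ + η * d → 0# < δ + η * (- d) → 0# < δ + s * d
  product-< {η} {s} {d} {δ} 0<η -η<s s<η lower upper =
    pos-cancelˡ (+-pos 0<η 0<η) (pos (+-pos (*-pos (positive-difference s<η) upper) (*-pos (positive-difference -η<s) lower))
      (solve 4 (λ η s d δ → (η :- s) :* (δ :+ η :* (:- d)) :+ (s :- (:- η)) :* (δ :+ η :* d)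
        := (η :+ η) :* (δ :+ s :* d)) refl η s d δ))

  -- Bisection of the unit interval between two covering predicates.

  module Bisection (A B : Carrier → Set) (cover : ∀ t → 0# ≤ t → t ≤ 1# → A t ⊎ B t) (A0 : A 0#) (B1 : B 1#) where

    -- The linear bound in `width` is weaker than the true halving rate but still tends to zero, and
    -- it avoids powers of two. The constant 2 makes it strict for the unit interval.
    record Bracket (k : ℕ) : Set where
      field
        a b   : Carrier
        0≤a   : 0# ≤ a
        a<b   : a < b
        b≤1   : b ≤ 1#
        a∈A   : A a
        b∈B   : B b
        width : fromℕ (suc k) * (b - a) < 1# + 1#

    open Bracket

    unitBracket : Bracket 0
    unitBracket = record
      { 0≤a = ≤-refl ; a<b = 0<1 ; b≤1 = ≤-refl ; a∈A = A0 ; b∈B = B1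
      ; width = <-from 0<1 (solve 0 (con (+ 1) := (con (+ 1) :+ con (+ 1)) :- ((con (+ 1) :+ con (+ 0)) :* (con (+ 1) :- con (+ 0)))) refl) }

    mid : ∀ {k} → Bracket k → Carrier
    mid I = a I + ½ * (b I - a I)

    mid-b : ∀ {k} (I : Bracket k) → b I - mid I ≈ ½ * (b I - a I)
    mid-b I = begin
      b I - mid I                          ≈⟨ solve 3 (λ a b h → b :- (a :+ h :* (b :- a)) := con (+ 1) :* (b :- a) :- h :* (b :- a)) refl (a I) (b I) ½ ⟩
      1# * (b I - a I) - ½ * (b I - a I)   ≈⟨ +-congʳ (*-congʳ ½+½) ⟨
      (½ + ½) * (b I - a I) - ½ * (b I - a I)  ≈⟨ solve 2 (λ w h → (h :+ h) :* w :- h :* w := h :* w) refl (b I - a I) ½ ⟩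
      ½ * (b I - a I)                      ∎

    0<½w : ∀ {k} (I : Bracket k) → 0# < ½ * (b I - a I)
    0<½w I = *-pos (0<inv 1) (positive-difference (a<b I))

    a<mid : ∀ {k} (I : Bracket k) → a I < mid I
    a<mid I = <-from (0<½w I) (solve 2 (λ a d → d := (a :+ d) :- a) refl (a I) _)

    mid<b : ∀ {k} (I : Bracket k) → mid I < b I
    mid<b I = <-from (0<½w I) (sym (mid-b I))

    -- Halving preserves the invariant because half of `k + 2` is at most `k + 1`.
    half-width : ∀ {k} (I : Bracket k) → fromℕ (suc (suc k)) * (½ * (b I - a I)) < 1# + 1#
    half-width {k} I = ≤-<-trans (≤-from (*-nonneg (<⇒≤ (0<½w I)) (0≤fromℕ k)) (begin
        ½ * w * F
          ≈⟨ solve 3 (λ h w F → h :* w :* F := (con (+ 1) :+ F) :* ((h :+ h) :* w) :- (con (+ 1) :+ (con (+ 1) :+ F)) :* (h :* w)) refl ½ w F ⟩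
        (1# + F) * ((½ + ½) * w) - (1# + (1# + F)) * (½ * w)
          ≈⟨ +-congʳ (*-congˡ (trans (*-congʳ ½+½) (*-identityˡ w))) ⟩
        (1# + F) * w - (1# + (1# + F)) * (½ * w) ∎)) (width I)
      where
      w = b I - a I
      F = fromℕ k

    -- `cover` chooses a side for the midpoint; a midpoint in `A` becomes the left end, one in `B`
    -- the right end.
    refine : ∀ {k} (I : Bracket k) →
      Σ[ J ∈ Bracket (suc k) ] a I ≤ a J × b J ≤ b I
    refine {k} I = [ left , right ]′
      (cover (mid I) (≤-trans (0≤a I) (<⇒≤ (a<mid I))) (≤-trans (<⇒≤ (mid<b I)) (b≤1 I)))
      where
      Refinement = Σ[ J ∈ Bracket (suc k) ] a I ≤ a J × b J ≤ b I
      left : A (mid I) → Refinement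
      left mid∈A = record
        { 0≤a = ≤-trans (0≤a I) (<⇒≤ (a<mid I)) ; a<b = mid<b I ; b≤1 = b≤1 I ; a∈A = mid∈A ; b∈B = b∈B I
        ; width = <-respˡ (*-congˡ (sym (mid-b I))) (half-width I) }
        , <⇒≤ (a<mid I) , ≤-refl
      right : B (mid I) → Refinement
      right mid∈B = record
        { 0≤a = 0≤a I ; a<b = a<mid I ; b≤1 = ≤-trans (<⇒≤ (mid<b I)) (b≤1 I) ; a∈A = a∈A I ; b∈B = mid∈B
        ; width = <-respˡ (*-congˡ (solve 2 (λ a d → d := (a :+ d) :- a) refl (a I) _)) (half-width I) }
        , ≤-refl , <⇒≤ (mid<b I)

    opaque
      bracket : ∀ k → Bracket k
      bracket zero    = unitBracket
      bracket (suc k) = proj₁ (refine (bracket k))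

      bracket-nested : ∀ k → a (bracket k) ≤ a (bracket (suc k)) × b (bracket (suc k)) ≤ b (bracket k)
      bracket-nested k = proj₂ (refine (bracket k))

    aₛ bₛ : ℕ → Carrier
    aₛ k = a (bracket k)
    bₛ k = b (bracket k)

    nested : ∀ {p q} → p ℕ.≤′ q → aₛ p ≤ aₛ q × bₛ q ≤ bₛ p
    nested ℕ.≤′-refl = ≤-refl , ≤-refl
    nested {q = suc q} (ℕ.≤′-step p≤q) =
      ≤-trans (proj₁ (nested p≤q)) (proj₁ (bracket-nested q)) ,
      ≤-trans (proj₂ (bracket-nested q)) (proj₂ (nested p≤q))

    a-mono : ∀ {p q} → p ℕ.≤ q → aₛ p ≤ aₛ q
    a-mono p≤q = proj₁ (nested (ℕ.≤⇒≤′ p≤q))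

    a<b-all : ∀ p q → aₛ p < bₛ q
    a<b-all p q = ≤-<-trans (a-mono (ℕ.m≤m⊔n p q))
      (<-≤-trans (a<b (bracket (p ℕ.⊔ q))) (proj₂ (nested (ℕ.≤⇒≤′ (ℕ.m≤n⊔m p q)))))

    private
      rescale : ∀ {δ i F x y t} → F * i ≈ 1# → (δ + i * (- t)) + i * (t - F * (y - x)) ≈ x + δ - y
      rescale {δ} {i} {F} {x} {y} {t} Fi≈1 = begin
        (δ + i * (- t)) + i * (t - F * (y - x))
          ≈⟨ solve 4 (λ δ i t G → (δ :+ i :* (:- t)) :+ i :* (t :- G) := δ :- i :* G) refl δ i t (F * (y - x)) ⟩
        δ - i * (F * (y - x))
          ≈⟨ solve 4 (λ δ i F w → δ :- i :* (F :* w) := δ :- (F :* i) :* w) refl δ i F (y - x) ⟩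
        δ - (F * i) * (y - x)  ≈⟨ +-congˡ (-‿cong (*-congʳ Fi≈1)) ⟩
        δ - 1# * (y - x)       ≈⟨ solve 3 (λ δ x y → δ :- con (+ 1) :* (y :- x) := (x :+ δ) :- y) refl δ x y ⟩
        x + δ - y              ∎

    -- Bracket `N` is shorter than `2 * inv N`, which is eventually below `δ`.
    shrinking : ∀ δ → 0# < δ → ∃[ N ] bₛ N < aₛ N + δ
    shrinking δ 0<δ = let (N , small) = eventually-< (- (1# + 1#)) 0<δ in
      N , <-from
        (+-pos (small N ℕ.≤-refl) (*-pos (0<inv N) (positive-difference (width (bracket N)))))
        (rescale (fromℕ*inv N))

    a-cauchy : IsCauchy aₛ
    a-cauchy δ 0<δ = N , λ p q N≤p N≤q → close p q N≤q , close q p N≤p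
      where
      N = proj₁ (shrinking δ 0<δ)
      close : ∀ p q → N ℕ.≤ q → aₛ p < aₛ q + δ
      close p q N≤q = <-≤-trans (<-trans (a<b-all p N) (proj₂ (shrinking δ 0<δ)))
        (≤-from (nonneg-difference (a-mono N≤q)) (solve 3 (λ x y δ → y :- x := (y :+ δ) :- (x :+ δ)) refl (aₛ N) (aₛ q) δ))

    opaque
      limit : Carrier
      limit = proj₁ (complete aₛ a-cauchy)

      converges : aₛ ConvergesTo limit
      converges = proj₂ (complete aₛ a-cauchy)

    a≤limit : ∀ k → aₛ k ≤ limit
    a≤limit k l<a = let (N , conv) = converges (aₛ k - limit) (positive-difference l<a) in a-mono (ℕ.m≤n⊔m N k) (<-respʳ
      (solve 2 (λ x l → l :+ (x :- l) := x) refl (aₛ k) limit) (proj₁ (conv (N ℕ.⊔ k) (ℕ.m≤m⊔n N k))))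

    limit≤b : ∀ k → limit ≤ bₛ k
    limit≤b k b<l = let (N , conv) = converges (limit - bₛ k) (positive-difference b<l) in <-asym (a<b-all N k) (<-from (positive-difference (proj₂ (conv N ℕ.≤-refl)))
      (solve 3 (λ x y l → (x :+ (l :- y)) :- l := x :- y) refl (aₛ N) (bₛ k) limit))

    -- The ends of a short bracket around the limit: whichever of the two predicates holds at the
    -- limit, points of the other lie arbitrarily near.
    approximations : ∀ δ → 0# < δ → ∃[ s ] ∃[ t ]
      (0# ≤ s × s ≤ 1# × A s × Within δ limit s) × (0# ≤ t × t ≤ 1# × B t × Within δ limit t)
    approximations δ 0<δ = aₛ N , bₛ N ,
      (0≤a I , ≤-trans (<⇒≤ (a<b I)) (b≤1 I) , a∈A I , ≤-<-trans (limit≤b N) small , ≤-<-trans (a≤limit N) (up limit)) ,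
      (≤-trans (0≤a I) (<⇒≤ (a<b I)) , b≤1 I , b∈B I , ≤-<-trans (limit≤b N) (up (bₛ N)) ,
        <-≤-trans small (≤-from (nonneg-difference (a≤limit N))
          (solve 3 (λ x l δ → l :- x := (l :+ δ) :- (x :+ δ)) refl (aₛ N) limit δ)))
      where
      N     = proj₁ (shrinking δ 0<δ)
      small = proj₂ (shrinking δ 0<δ)
      I     = bracket N
      up : ∀ x → x < x + δ
      up x = <-from 0<δ (solve 2 (λ x δ → δ := (x :+ δ) :- x) refl x δ)

    0≤limit : 0# ≤ limit
    0≤limit = ≤-trans (0≤a (bracket 0)) (a≤limit 0)

    limit≤1 : limit ≤ 1#
    limit≤1 = ≤-trans (limit≤b 0) (b≤1 (bracket 0))

-- Finite sums of reals.

module Sums (ℝ : RealNumbers) where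

  open RealNumbers ℝ hiding (zero)
  open OrderedField ℝ
  open SemiringSum semiring public using (sum-cong-≋; *-distribʳ-sum)
  open ≈-Reasoning setoid

  sum-difference : ∀ {k} (c f g : Vector Carrier k) →
    sum (λ i → c i * (f i - g i)) ≈ sum (λ i → c i * f i) - sum (λ i → c i * g i)
  sum-difference {zero}  c f g = solve 0 (con (+ 0) := con (+ 0) :- con (+ 0)) refl
  sum-difference {suc k} c f g = trans (+-congˡ (sum-difference (c ∘ Fin.suc) (f ∘ Fin.suc) (g ∘ Fin.suc)))
    (solve 5 (λ c f g x y → c :* (f :- g) :+ (x :- y) := (c :* f :+ x) :- (c :* g :+ y)) refl
      (c Fin.zero) (f Fin.zero) (g Fin.zero) _ _)

  sum-combination : ∀ {k} s t (f g : Vector Carrier k) →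
    sum (λ i → s * f i + t * g i) ≈ s * sum f + t * sum g
  sum-combination {zero}  s t f g = solve 2 (λ s t → con (+ 0) := s :* con (+ 0) :+ t :* con (+ 0)) refl s t
  sum-combination {suc k} s t f g = trans (+-congˡ (sum-combination s t (f ∘ Fin.suc) (g ∘ Fin.suc)))
    (rearranged s t (f Fin.zero) (g Fin.zero) _ _)
    where
    rearranged : ∀ s t f g x y → (s * f + t * g) + (s * x + t * y) ≈ s * (f + x) + t * (g + y)
    rearranged s t f g x y = begin
      (s * f + t * g) + (s * x + t * y)  ≈⟨ solve 4 (λ a b c d → (a :+ b) :+ (c :+ d) := (a :+ c) :+ (b :+ d)) refl _ _ _ _ ⟩
      (s * f + s * x) + (t * g + t * y)  ≈⟨ +-cong (distribˡ s f x) (distribˡ t g y) ⟨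
      s * (f + x) + t * (g + y)          ∎

  sum-constant : ∀ k c → sum {k} (λ _ → c) ≈ fromℕ k * c
  sum-constant zero    c = sym (zeroˡ c)
  sum-constant (suc k) c = trans (+-congˡ (sum-constant k c))
    (solve 2 (λ F c → c :+ F :* c := (con (+ 1) :+ F) :* c) refl (fromℕ k) c)

  sum-indicator : ∀ {k} (x : Vector Carrier k) a →
    sum (λ j → x j * (if does (a Fin.≟ j) then 1# else 0#)) ≈ x a
  sum-indicator {suc k} x Fin.zero = begin
    x Fin.zero * 1# + sum (λ j → x (Fin.suc j) * 0#)  ≈⟨ +-cong (sym (*-identityʳ _)) (*-distribʳ-sum 0# (x ∘ Fin.suc)) ⟨
    x Fin.zero + sum (x ∘ Fin.suc) * 0#               ≈⟨ +-congˡ (zeroʳ _) ⟩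
    x Fin.zero + 0#                                   ≈⟨ +-identityʳ _ ⟩
    x Fin.zero                                        ∎
  sum-indicator {suc k} x (Fin.suc a) = begin
    x Fin.zero * 0# + sum (λ j → x (Fin.suc j) * (if does (a Fin.≟ j) then 1# else 0#))
      ≈⟨ +-cong (zeroʳ _) (sum-indicator (x ∘ Fin.suc) a) ⟩
    0# + x (Fin.suc a)  ≈⟨ +-identityˡ _ ⟩
    x (Fin.suc a)       ∎

-- Pairings, segments and the topology of V.

module Geometry (ℝ : RealNumbers) (n : ℕ) where

  open RealNumbers ℝ hiding (zero)
  open OrderedField ℝ
  open Sums ℝ
  open TypeA ℝ n
  open ≈-Reasoning setoid

  pairing-difference : ∀ v α → pairing v α ≈ coord v (inject₁ (PositiveRoot.i α)) - coord v (Fin.suc (PositiveRoot.j α))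
  pairing-difference v (mkRoot i j _) = trans
    (sum-difference (coord v) (ε (inject₁ i)) (ε (Fin.suc j)))
    (+-cong (sum-indicator (coord v) (inject₁ i)) (-‿cong (sum-indicator (coord v) (Fin.suc j))))

  opaque
    -- There are `suc n` coordinates, so `inv n * sum u` is their mean.
    centre-sum : ∀ (u : Vector Carrier (suc n)) → sum (λ a → 1# * u a + - inv n * sum u) ≈ 0#
    centre-sum u = begin
      sum (λ a → 1# * u a + - inv n * sum u)            ≈⟨ sum-combination 1# (- inv n) u (λ _ → sum u) ⟩
      1# * sum u + - inv n * sum {suc n} (λ _ → sum u)  ≈⟨ +-congˡ (*-congˡ (sum-constant (suc n) (sum u))) ⟩
      1# * sum u + - inv n * (fromℕ (suc n) * sum u)
        ≈⟨ solve 3 (λ S i F → con (+ 1) :* S :+ (:- i) :* (F :* S) := S :- (F :* i) :* S) refl (sum u) (inv n) (fromℕ (suc n)) ⟩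
      sum u - (fromℕ (suc n) * inv n) * sum u           ≈⟨ +-congˡ (-‿cong (*-congʳ (fromℕ*inv n))) ⟩
      sum u - 1# * sum u                                ≈⟨ solve 1 (λ S → S :- con (+ 1) :* S := con (+ 0)) refl (sum u) ⟩
      0#                                                ∎

    segment-sum : ∀ x y t → sum (λ i → (1# - t) * coord x i + t * coord y i) ≈ 0#
    segment-sum x y t = begin
      sum (λ i → (1# - t) * coord x i + t * coord y i)  ≈⟨ sum-combination (1# - t) t (coord x) (coord y) ⟩
      (1# - t) * sum (coord x) + t * sum (coord y)      ≈⟨ +-cong (*-congˡ (sum≈0 x)) (*-congˡ (sum≈0 y)) ⟩
      (1# - t) * 0# + t * 0#                            ≈⟨ solve 1 (λ t → (con (+ 1) :- t) :* con (+ 0) :+ t :* con (+ 0) := con (+ 0)) refl t ⟩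
      0#                                                ∎

  -- Translation along (1, …, 1) onto the hyperplane V; it leaves all pairings unchanged.
  centre : Vector Carrier (suc n) → V
  centre u = mkV (λ a → 1# * u a + - inv n * sum u) (centre-sum u)

  segment : V → V → Carrier → V
  segment x y t = mkV (λ i → (1# - t) * coord x i + t * coord y i) (segment-sum x y t)

  pairing-centre : ∀ u α → pairing (centre u) α ≈ u (inject₁ (PositiveRoot.i α)) - u (Fin.suc (PositiveRoot.j α))
  pairing-centre u α = trans (pairing-difference (centre u) α)
    (solve 3 (λ a b c → (con (+ 1) :* a :+ c) :- (con (+ 1) :* b :+ c) := a :- b) refl _ _ _)

  pairing-segment : ∀ x y t α → pairing (segment x y t) α ≈ (1# - t) * pairing x α + t * pairing y α
  pairing-segment x y t α = trans (pairing-difference (segment x y t) α) (trans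
    (combine (1# - t) t _ _ _ _)
    (sym (+-cong (*-congˡ (pairing-difference x α)) (*-congˡ (pairing-difference y α)))))
    where
    combine : ∀ r t a b c d → (r * a + t * b) - (r * c + t * d) ≈ r * (a - c) + t * (b - d)
    combine r t a b c d = begin
      (r * a + t * b) - (r * c + t * d)
        ≈⟨ solve 4 (λ p q u v → (p :+ q) :- (u :+ v) := (p :- u) :+ (q :- v)) refl _ _ _ _ ⟩
      (r * a - r * c) + (t * b - t * d)
        ≈⟨ +-cong (solve 3 (λ r a c → r :* a :- r :* c := r :* (a :- c)) refl r a c)
                  (solve 3 (λ r a c → r :* a :- r :* c := r :* (a :- c)) refl t b d) ⟩
      r * (a - c) + t * (b - d)          ∎

  -- Either `0# < t` or `t < 1#` can be established, and in each case one summand is positive and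
  -- the other nonnegative.
  convex-pos : ∀ {A B t} → 0# < A → 0# < B → 0# ≤ t → t ≤ 1# → 0# < (1# - t) * A + t * B
  convex-pos {A} {B} {t} 0<A 0<B 0≤t t≤1 =
    [ (λ 0<t → <-respʳ (+-comm _ _) (+-pos-nonneg (*-pos 0<t 0<B) (*-nonneg (nonneg-difference t≤1) (<⇒≤ 0<A))))
    , (λ t<1 → +-pos-nonneg (*-pos (positive-difference t<1) 0<A) (*-nonneg 0≤t (<⇒≤ 0<B)))
    ]′ (<-cotrans 0<1 t)

  segment-above : ∀ {x y t α c} → 0# ≤ t → t ≤ 1# → c < pairing x α → c < pairing y α → c < pairing (segment x y t) α
  segment-above {x} {y} {t} {α} {c} 0≤t t≤1 c<x c<y = <-respʳ (sym (pairing-segment x y t α))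
    (<-from (convex-pos (positive-difference c<x) (positive-difference c<y) 0≤t t≤1)
      (solve 4 (λ t a b c → (con (+ 1) :- t) :* (a :- c) :+ t :* (b :- c) := ((con (+ 1) :- t) :* a :+ t :* b) :- c)
        refl t (pairing x α) (pairing y α) c))

  segment-below : ∀ {x y t α c} → 0# ≤ t → t ≤ 1# → pairing x α < c → pairing y α < c → pairing (segment x y t) α < c
  segment-below {x} {y} {t} {α} {c} 0≤t t≤1 x<c y<c = <-respˡ (sym (pairing-segment x y t α))
    (<-from (convex-pos (positive-difference x<c) (positive-difference y<c) 0≤t t≤1)
      (solve 4 (λ t a b c → (con (+ 1) :- t) :* (c :- a) :+ t :* (c :- b) := c :- ((con (+ 1) :- t) :* a :+ t :* b))
        refl t (pairing x α) (pairing y α) c))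

  within-≈ : ∀ {δ a b} → 0# < δ → a ≈ b → Within δ a b
  within-≈ {δ} {a} {b} 0<δ a≈b = <-from 0<δ (eq a≈b) , <-from 0<δ (eq (sym a≈b))
    where
    eq : ∀ {a b} → a ≈ b → δ ≈ b + δ - a
    eq {a} {b} a≈b = trans (solve 2 (λ b δ → δ := (b :+ δ) :- b) refl b δ) (+-congˡ (-‿cong (sym a≈b)))

  -- Each coordinate is affine in the parameter with slope `d i`; finitely many slopes admit one `η`
  -- for which `η * d i` stays between `- δ` and `δ`.
  segment-continuous : ∀ x y δ → 0# < δ → ∃[ η ] (0# < η × (∀ s t → Within η s t → Ball (segment x y s) δ (segment x y t)))
  segment-continuous x y δ 0<δ = inv N , 0<inv N , close
    where
    d : Fin (suc n) → Carrier
    d i = coord y i - coord x i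
    small : Eventually (λ k → ∀ i → 0# < δ + inv k * d i × 0# < δ + inv k * (- d i))
    small = Eventually-∀ (λ i → Eventually-zip _,_ (eventually-< (d i) 0<δ) (eventually-< (- d i) 0<δ))
    N = proj₁ small
    step : ∀ s t i → Within (inv N) s t → (1# - s) * coord x i + s * coord y i < (1# - t) * coord x i + t * coord y i + δ
    step s t i (s<t+η , t<s+η) = <-from
      (product-< (0<inv N)
        (<-from (positive-difference s<t+η) (solve 3 (λ s t η → (t :+ η) :- s := (t :- s) :- (:- η)) refl s t (inv N)))
        (<-from (positive-difference t<s+η) (solve 3 (λ s t η → (s :+ η) :- t := η :- (t :- s)) refl s t (inv N)))
        (proj₁ (proj₂ small N ℕ.≤-refl i)) (proj₂ (proj₂ small N ℕ.≤-refl i)))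
      (solve 5 (λ s t δ x y → δ :+ (t :- s) :* (y :- x)
          := ((con (+ 1) :- t) :* x :+ t :* y :+ δ) :- ((con (+ 1) :- s) :* x :+ s :* y))
        refl s t δ (coord x i) (coord y i))
    close : ∀ s t → Within (inv N) s t → Ball (segment x y s) δ (segment x y t)
    close s t w i = step s t i w , step t s i (proj₂ w , proj₁ w)

  -- A pairing is a difference of two coordinates, each of which moves by less than half of `e`.
  pairing-continuous : ∀ {x y e} α → Ball x (½ * e) y → Within e (pairing x α) (pairing y α)
  pairing-continuous {x} {y} {e} α near =
    bound x y (λ i → proj₁ (near i)) (λ i → proj₂ (near i)) , bound y x (λ i → proj₂ (near i)) (λ i → proj₁ (near i))
    where
    bound : ∀ x y → (∀ i → coord x i < coord y i + ½ * e) → (∀ i → coord y i < coord x i + ½ * e) → pairing x α < pairing y α + e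
    bound x y up down = <-respˡ (sym (pairing-difference x α)) (<-respʳ (+-congʳ (sym (pairing-difference y α)))
      (<-from (+-pos (positive-difference (up a)) (positive-difference (down b))) (begin
        (coord y a + ½ * e - coord x a) + (coord x b + ½ * e - coord y b)
          ≈⟨ solve 5 (λ ya xa xb yb h → (ya :+ h :- xa) :+ (xb :+ h :- yb) := ((ya :- yb) :+ (h :+ h)) :- (xa :- xb)) refl _ _ _ _ _ ⟩
        coord y a - coord y b + (½ * e + ½ * e) - (coord x a - coord x b)
          ≈⟨ +-congʳ (+-congˡ (trans (sym (distribʳ e ½ ½)) (trans (*-congʳ ½+½) (*-identityˡ e)))) ⟩
        coord y a - coord y b + e - (coord x a - coord x b) ∎)))
      where
      a = inject₁ (PositiveRoot.i α)
      b = Fin.suc (PositiveRoot.j α)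

  below-open : ∀ α k → IsOpen (Below α k)
  below-open α k {x} x<k = ½ * (fromℕ k - pairing x α) , *-pos (0<inv 1) (positive-difference x<k) ,
    λ {y} near → <-respʳ (solve 2 (λ p k → p :+ (k :- p) := k) refl (pairing x α) (fromℕ k)) (proj₂ (pairing-continuous {x} {y} α near))

  above-open : ∀ α k → IsOpen (Above α k)
  above-open α k {x} k<x = ½ * (pairing x α - fromℕ k) , *-pos (0<inv 1) (positive-difference k<x) ,
    λ {y} near → <-from (positive-difference (proj₁ (pairing-continuous {x} {y} α near)))
      (solve 3 (λ p q k → (q :+ (p :- k)) :- p := q :- k) refl (pairing x α) (pairing y α) (fromℕ k))

  -- Bisect the segment from a point of `U` to a point of `W`. The limit lies in `U` or in `W`, and
  -- openness of that set captures a nearby bracket end belonging to the other one.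
  convex⇒connected : ∀ {C : Pred V 0ℓ} →
    (∀ x y t → x ∈ C → y ∈ C → 0# ≤ t → t ≤ 1# → segment x y t ∈ C) → IsConnected C
  convex⇒connected {C} convex U W U-open W-open C⊆U∪W (x , x∈C , x∈U) (y , y∈C , y∈W) =
    [ limit∈U , limit∈W ]′ (C⊆U∪W (convex x y limit x∈C y∈C 0≤limit limit≤1))
    where
    P : Carrier → V
    P = segment x y
    -- The start of the segment agrees with `x` only up to `≈`. An open set containing `x` contains
    -- it too, since it lies in every ball around `x`.
    P0∈U : P 0# ∈ U
    P0∈U = let (δ , 0<δ , ball⊆U) = U-open x∈U in ball⊆U λ i → within-≈ 0<δ
      (solve 2 (λ a b → a := (con (+ 1) :- con (+ 0)) :* a :+ con (+ 0) :* b) refl (coord x i) (coord y i))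
    P1∈W : P 1# ∈ W
    P1∈W = let (δ , 0<δ , ball⊆W) = W-open y∈W in ball⊆W λ i → within-≈ 0<δ
      (solve 2 (λ a b → b := (con (+ 1) :- con (+ 1)) :* a :+ con (+ 1) :* b) refl (coord x i) (coord y i))
    open Bisection (λ t → P t ∈ U) (λ t → P t ∈ W) (λ t 0≤t t≤1 → C⊆U∪W (convex x y t x∈C y∈C 0≤t t≤1)) P0∈U P1∈W
    limit∈U : P limit ∈ U → Satisfiable (C ∩ (U ∩ W))
    limit∈U l∈U =
      let (δ , 0<δ , ball⊆U)                    = U-open l∈U
          (η , 0<η , close)                     = segment-continuous x y δ 0<δ
          (_ , t , _ , (0≤t , t≤1 , t∈W , near)) = approximations η 0<η
      in P t , convex x y t x∈C y∈C 0≤t t≤1 , ball⊆U (close limit t near) , t∈W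
    limit∈W : P limit ∈ W → Satisfiable (C ∩ (U ∩ W))
    limit∈W l∈W =
      let (δ , 0<δ , ball⊆W)                    = W-open l∈W
          (η , 0<η , close)                     = segment-continuous x y δ 0<δ
          (s , _ , (0≤s , s≤1 , s∈U , near) , _) = approximations η 0<η
      in P s , convex x y s x∈C y∈C 0≤s s≤1 , s∈U , ball⊆W (close limit s near)

-- Sums of natural numbers and a discrete intermediate value theorem.

module NaturalSums where

  open import Data.Nat.Base using (_+_; _*_; _∸_; _≤_; _<_)
  open SemiringSum ℕ.+-*-semiring public using (sum; sum-cong-≗)

  sum-mono-≤ : ∀ {n} {f g : Fin n → ℕ} → (∀ i → f i ≤ g i) → sum f ≤ sum g
  sum-mono-≤ {zero}  f≤g = ℕ.z≤n
  sum-mono-≤ {suc n} f≤g = ℕ.+-mono-≤ (f≤g Fin.zero) (sum-mono-≤ (f≤g ∘ Fin.suc))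

  sum-mono-< : ∀ {n} {f g : Fin n → ℕ} → (∀ i → f i ≤ g i) → ∀ i → f i < g i → sum f < sum g
  sum-mono-< {suc n} f≤g Fin.zero    f<g = ℕ.+-mono-<-≤ f<g (sum-mono-≤ (f≤g ∘ Fin.suc))
  sum-mono-< {suc n} f≤g (Fin.suc i) f<g = ℕ.+-mono-≤-< (f≤g Fin.zero) (sum-mono-< (f≤g ∘ Fin.suc) i f<g)

  -- Otherwise `f` would be at most `g` everywhere and smaller at `i`, so the sums would differ.
  sum-compensation : ∀ {n} {f g : Fin n → ℕ} → sum f ≡ sum g → ∀ i → f i < g i → ∃[ j ] g j < f j
  sum-compensation {f = f} {g} eq i f<g with Fin.any? (λ j → g j ℕ.<? f j)
  ... | yes g<f = g<f
  ... | no  g≮f = contradiction eq (ℕ.<⇒≢ (sum-mono-< (λ j → ℕ.≮⇒≥ (g≮f ∘ (j ,_))) i f<g))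

  sum-const : ∀ {n} {f : Fin n → ℕ} {c} → (∀ i → f i ≡ c) → sum f ≡ n * c
  sum-const {zero}  f≡c = ≡.refl
  sum-const {suc n} f≡c = ≡.cong₂ _+_ (f≡c Fin.zero) (sum-const (f≡c ∘ Fin.suc))

  sum-replicate : ∀ n c → sum {n} (λ _ → c) ≡ n * c
  sum-replicate n c = sum-const {n} {c = c} (λ _ → ≡.refl)

  sum-tail : ∀ {n} {f : Fin n → ℕ} {c} (i : Fin n) →
    (∀ j → j Fin.< i → f j ≡ 0) → (∀ j → i Fin.≤ j → f j ≡ c) → sum f ≡ (n ∸ toℕ i) * c
  sum-tail Fin.zero    f≡0 f≡c = sum-const (λ j → f≡c j ℕ.z≤n)
  sum-tail (Fin.suc i) f≡0 f≡c rewrite f≡0 Fin.zero ℕ.z<s =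
    sum-tail i (λ j j<i → f≡0 (Fin.suc j) (ℕ.s<s j<i)) (λ j i≤j → f≡c (Fin.suc j) (ℕ.s≤s i≤j))

  sum-tail-≤ : ∀ {n} {f : Fin n → ℕ} {c} (i : Fin n) →
    (∀ j → j Fin.< i → f j ≡ 0) → (∀ j → f j ≤ c) → sum f ≤ (n ∸ toℕ i) * c
  sum-tail-≤ {suc n} {c = c} Fin.zero f≡0 f≤c = ℕ.≤-trans (sum-mono-≤ f≤c) (ℕ.≤-reflexive (sum-replicate (suc n) c))
  sum-tail-≤ (Fin.suc i) f≡0 f≤c rewrite f≡0 Fin.zero ℕ.z<s =
    sum-tail-≤ i (λ j j<i → f≡0 (Fin.suc j) (ℕ.s<s j<i)) (f≤c ∘ Fin.suc)

  -- The bound counts `c` once for every index from `i` on, so a smaller entry at `i` would make the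
  -- sum strictly smaller.
  sum-tail-max : ∀ {n} {f : Fin n → ℕ} {c} (i : Fin n) →
    (∀ j → j Fin.< i → f j ≡ 0) → (∀ j → f j ≤ c) → sum f ≡ (n ∸ toℕ i) * c → f i ≡ c
  sum-tail-max {suc n} {c = c} Fin.zero f≡0 f≤c eq = [ (λ f<c → contradiction (≡.trans eq (≡.sym (sum-replicate (suc n) c)))
      (ℕ.<⇒≢ (sum-mono-< f≤c Fin.zero f<c))) , (λ f≡c → f≡c) ]′ (ℕ.m≤n⇒m<n∨m≡n (f≤c Fin.zero))
  sum-tail-max (Fin.suc i) f≡0 f≤c eq rewrite f≡0 Fin.zero ℕ.z<s =
    sum-tail-max i (λ j j<i → f≡0 (Fin.suc j) (ℕ.s<s j<i)) (f≤c ∘ Fin.suc) eq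

  sum-unit-jump : ∀ {n} {f g : Fin n → ℕ} → (∀ i → g i ≤ suc (f i)) →
    (∀ {i j} → f i < g i → f j < g j → i ≡ j) → sum g ≤ suc (sum f)
  sum-unit-jump {zero} g≤1+f unique = ℕ.z≤n
  sum-unit-jump {suc n} {f} {g} g≤1+f unique with f Fin.zero ℕ.<? g Fin.zero
  ... | yes f<g = ℕ.+-mono-≤ (g≤1+f Fin.zero) (sum-mono-≤ tail≤)
    where
    tail≤ : ∀ j → g (Fin.suc j) ≤ f (Fin.suc j)
    tail≤ j = ℕ.≮⇒≥ λ f<g′ → Fin.0≢1+n (unique f<g f<g′)
  ... | no  f≮g = ℕ.≤-trans
    (ℕ.+-mono-≤ (ℕ.≮⇒≥ f≮g) (sum-unit-jump (g≤1+f ∘ Fin.suc) (λ p q → Fin.suc-injective (unique p q))))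
    (ℕ.≤-reflexive (ℕ.+-suc (f Fin.zero) _))

  -- If `y` exceeds `f N`, then `y ≤ f (suc N) ≤ suc (f N) ≤ y`, so the value is attained at
  -- `suc N`; otherwise a smaller bound works.
  discrete-IVT : ∀ {f : ℕ → ℕ} {y} → (∀ t → f (suc t) ≤ suc (f t)) →
    f 0 ≤ y → ∀ N → y ≤ f N → ∃[ t ] f t ≡ y
  discrete-IVT         step f0≤y zero    y≤fN = 0 , ℕ.≤-antisym f0≤y y≤fN
  discrete-IVT {f} {y} step f0≤y (suc N) y≤fN with y ℕ.≤? f N
  ... | yes y≤fN′ = discrete-IVT step f0≤y N y≤fN′
  ... | no  y≰fN  = suc N , ℕ.≤-antisym (ℕ.≤-trans (step N) (ℕ.≰⇒> y≰fN)) y≤fN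

-- Integer quotients.

module Floor where

  open import Data.Nat.Base using (_+_; _*_; _∸_; _≤_; _<_; _/_; NonZero)

  ≤-quotient : ∀ {c x} M .{{_ : NonZero M}} → c * M ≤ x → c ≤ x / M
  ≤-quotient {c} M cM≤x = ≡.subst (_≤ _) (m*n/n≡m c M) (/-monoˡ-≤ M cM≤x)

  quotient-≤ : ∀ {c x} M .{{_ : NonZero M}} → c ≤ x / M → c * M ≤ x
  quotient-≤ {x = x} M c≤x/M = ℕ.≤-trans (ℕ.*-monoˡ-≤ M c≤x/M) (m/n*n≤m x M)

  quotient-< : ∀ {c x} M .{{_ : NonZero M}} → x / M < c → x < c * M
  quotient-< M x/M<c = ℕ.≰⇒> λ cM≤x → ℕ.<⇒≱ x/M<c (≤-quotient M cM≤x)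

  quotient-suc : ∀ x M .{{_ : NonZero M}} → suc x / M ≤ suc (x / M)
  quotient-suc x M = ℕ.s≤s⁻¹ (m<n*o⇒m/o<n {n = suc (suc (x / M))} (ℕ.≤-<-trans
    (quotient-< M ℕ.≤-refl) (ℕ.m<n+m _ (ℕ.>-nonZero⁻¹ M))))

  -- The multiple of `M` given by the new quotient is above `x` and at most `suc x`, hence equal to
  -- `suc x`.
  quotient-jump : ∀ x M .{{_ : NonZero M}} → x / M < suc x / M → M ∣ suc x
  quotient-jump x M jump = divides (suc x / M) (ℕ.≤-antisym
    (quotient-< M jump) (m/n*n≤m (suc x) M))

  -- Multiples of `2 * M` are even, so adding one to `2 * k` never reaches the next multiple.
  odd-quotient : ∀ k M .{{_ : NonZero M}} .{{_ : NonZero (2 * M)}} → suc (2 * k) / (2 * M) ≡ k / M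
  odd-quotient k M = ℕ.≤-antisym
    (ℕ.s≤s⁻¹ (m<n*o⇒m/o<n {n = suc (k / M)} below))
    (≤-quotient (2 * M) (ℕ.≤-trans (ℕ.≤-reflexive (double (k / M))) (ℕ.m≤n⇒m≤1+n (ℕ.*-monoʳ-≤ 2 (m/n*n≤m k M)))))
    where
    open ℕ.≤-Reasoning
    double : ∀ c → c * (2 * M) ≡ 2 * (c * M)
    double c = ≡.trans (≡.sym (ℕ.*-assoc c 2 M)) (≡.trans (≡.cong (_* M) (ℕ.*-comm c 2)) (ℕ.*-assoc 2 c M))
    below : suc (2 * k) < suc (k / M) * (2 * M)
    below = begin
      suc (suc (2 * k))          ≡⟨ ℕ.*-suc 2 k ⟨
      2 * suc k                  ≤⟨ ℕ.*-monoʳ-≤ 2 (quotient-< M ℕ.≤-refl) ⟩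
      2 * (suc (k / M) * M)      ≡⟨ double (suc (k / M)) ⟨
      suc (k / M) * (2 * M)      ∎

  2∤odd : ∀ k → ¬ 2 ∣ suc (2 * k)
  2∤odd k 2∣odd with ∣1⇒≡1 (∣m+n∣m⇒∣n (≡.subst (2 ∣_) (ℕ.+-comm 1 (2 * k)) 2∣odd) (m∣m*n k))
  ... | ()

-- Integer configurations with prescribed row sums.

module _ (m : ℕ) where

  open NaturalSums
  open Floor
  open import Data.Nat.Base using (_+_; _*_; _∸_; _≤_; _<_; _/_; _⊓_; NonZero)

  truncated-0 : ∀ {x} M .{{_ : NonZero M}} → x ≡ 0 → m ⊓ (x / M) ≡ 0
  truncated-0 M ≡.refl = ≡.trans (≡.cong (m ⊓_) (0/n≡0 M)) (ℕ.⊓-zeroʳ m)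

  -- Points on a line in which `scale` integer steps make a unit length. `incongruent` says that no
  -- difference is a whole number of units, which keeps the point of V off all hyperplanes. Columns
  -- with `j` before `i` contribute zero through truncated subtraction.
  record Configuration {n} (rows : Fin n → ℕ) : Set where
    field
      scale         : ℕ
      {{scale≢0}}   : NonZero scale
      position      : Fin (suc n) → ℕ
      antitone      : ∀ {a b} → a Fin.< b → position b < position a
      incongruent   : ∀ {a b} → a Fin.< b → ¬ scale ∣ position a ∸ position b
      row-sum       : ∀ i → sum (λ j → m ⊓ ((position (inject₁ i) ∸ position (Fin.suc j)) / scale)) ≡ rows i

    position≤first : ∀ b → position b ≤ position Fin.zero
    position≤first Fin.zero    = ℕ.≤-refl
    position≤first (Fin.suc b) = ℕ.<⇒≤ (antitone ℕ.z<s)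

    position-≤ : ∀ {a b} → a Fin.≤ b → position b ≤ position a
    position-≤ {a} {b} a≤b with Fin.<-cmp a b
    ... | tri< a<b _ _ = ℕ.<⇒≤ (antitone a<b)
    ... | tri≈ _ ≡.refl _ = ℕ.≤-refl
    ... | tri> _ _ b<a = contradiction a≤b (ℕ.<⇒≱ b<a)

  open Configuration

  module Extend {n} {rows : Fin (suc n) → ℕ} (C : Configuration (rows ∘ Fin.suc))
    (decreasing : ∀ {i j} → i Fin.≤ j → rows j ≤ rows i) (bounded : rows Fin.zero ≤ suc n * m) where

    M = scale C
    p = position C
    p₀ = p Fin.zero

    gap : Fin (suc n) → ℕ
    gap b = p₀ ∸ p b

    -- The first row sum produced by a new point at distance t above the old first point.
    count : ℕ → ℕ
    count t = sum (λ b → m ⊓ ((gap b + t) / M))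

    -- If the distances to two old points were multiples of `M` at once, so would be the distance
    -- between these points.
    gap-jump-unique : ∀ {t a b} → a Fin.< b → M ∣ suc (gap a + t) → ¬ M ∣ suc (gap b + t)
    gap-jump-unique {t} {a} {b} a<b Ma Mb = incongruent C a<b (∣m+n∣m⇒∣n (≡.subst (M ∣_) shift Mb) Ma)
      where
      open ≡.≡-Reasoning
      shift : suc (gap b + t) ≡ suc (gap a + t) + (p a ∸ p b)
      shift = ≡.cong suc (begin
        (p₀ ∸ p b) + t                   ≡⟨ ≡.cong (λ z → (z ∸ p b) + t) (ℕ.m∸n+n≡m (position≤first C a)) ⟨
        ((p₀ ∸ p a) + p a ∸ p b) + t     ≡⟨ ≡.cong (_+ t) (ℕ.+-∸-assoc (gap a) (ℕ.<⇒≤ (antitone C a<b))) ⟩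
        (gap a + (p a ∸ p b)) + t        ≡⟨ ℕ.+-assoc (gap a) _ t ⟩
        gap a + ((p a ∸ p b) + t)        ≡⟨ ≡.cong (λ z → gap a + z) (ℕ.+-comm _ t) ⟩
        gap a + (t + (p a ∸ p b))        ≡⟨ ℕ.+-assoc (gap a) t _ ⟨
        (gap a + t) + (p a ∸ p b)        ∎)

    truncated-jump : ∀ {x y} → m ⊓ x < m ⊓ y → x < y
    truncated-jump lt = ℕ.≰⇒> λ y≤x → ℕ.<⇒≱ lt (ℕ.⊓-monoʳ-≤ m y≤x)

    -- A summand can rise only when its new distance is a multiple of `M`, and then by at most one;
    -- incongruence allows this for at most one old point at a time.
    count-step : ∀ t → count (suc t) ≤ suc (count t)
    count-step t = sum-unit-jump small unique
      where
      small : ∀ b → m ⊓ ((gap b + suc t) / M) ≤ suc (m ⊓ ((gap b + t) / M))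
      small b = ℕ.≤-trans
        (ℕ.⊓-mono-≤ (ℕ.n≤1+n m) (≡.subst (λ z → z / M ≤ suc ((gap b + t) / M)) (≡.sym (ℕ.+-suc (gap b) t)) (quotient-suc (gap b + t) M)))
        ℕ.≤-refl
      jump : ∀ b → m ⊓ ((gap b + t) / M) < m ⊓ ((gap b + suc t) / M) → M ∣ suc (gap b + t)
      jump b lt = quotient-jump (gap b + t) M
        (≡.subst (λ z → (gap b + t) / M < z / M) (ℕ.+-suc (gap b) t) (truncated-jump lt))
      unique : ∀ {a b} → m ⊓ ((gap a + t) / M) < m ⊓ ((gap a + suc t) / M) →
        m ⊓ ((gap b + t) / M) < m ⊓ ((gap b + suc t) / M) → a ≡ b
      unique {a} {b} la lb with Fin.<-cmp a b
      ... | tri< a<b _ _ = contradiction (jump b lb) (gap-jump-unique a<b (jump a la))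
      ... | tri≈ _ a≡b _ = a≡b
      ... | tri> _ _ b<a = contradiction (jump a la) (gap-jump-unique b<a (jump b lb))

    -- At distance zero the new point coincides with the old first point. That point contributes
    -- nothing, and the others give the old first row sum, which the monotonicity of `rows` bounds.
    -- The helper `go` frees `n` for the case split.
    count-0 : count 0 ≤ rows Fin.zero
    count-0 = go C decreasing
      where
      go : ∀ {n} {rows : Fin (suc n) → ℕ} (C : Configuration (rows ∘ Fin.suc)) →
        (∀ {i j} → i Fin.≤ j → rows j ≤ rows i) →
        sum (λ b → m ⊓ ((position C Fin.zero ∸ position C b + 0) / scale C)) ≤ rows Fin.zero
      go {zero} C decreasing = ℕ.≤-trans (ℕ.≤-reflexive (≡.trans (ℕ.+-identityʳ _)
        (truncated-0 (scale C) (≡.trans (ℕ.+-identityʳ _) (ℕ.n∸n≡0 (position C Fin.zero)))))) ℕ.z≤n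
      go {suc n} {rows} C decreasing = begin
        sum (λ b → m ⊓ ((position C Fin.zero ∸ position C b + 0) / scale C))
          ≡⟨ sum-cong-≗ (λ b → ≡.cong (m ⊓_) (/-congˡ {o = scale C} (ℕ.+-identityʳ (position C Fin.zero ∸ position C b)))) ⟩
        m ⊓ ((position C Fin.zero ∸ position C Fin.zero) / scale C) + sum (λ j → m ⊓ ((position C Fin.zero ∸ position C (Fin.suc j)) / scale C))
          ≡⟨ ≡.cong₂ _+_ (truncated-0 (scale C) (ℕ.n∸n≡0 (position C Fin.zero))) (row-sum C Fin.zero) ⟩
        rows (Fin.suc Fin.zero)  ≤⟨ decreasing ℕ.z≤n ⟩
        rows Fin.zero            ∎
        where
        open ℕ.≤-Reasoning

    -- At `m` units above the old first point every quotient is at least `m`, so each summand is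
    -- truncated to `m`.
    count-large : rows Fin.zero ≤ count (m * M)
    count-large = ℕ.≤-trans bounded (ℕ.≤-reflexive (≡.sym (sum-const λ b →
      ℕ.m≤n⇒m⊓n≡m (≤-quotient M (ℕ.m≤n+m (m * M) (gap b))))))

    private
      target : ∃[ t ] count t ≡ rows Fin.zero
      target = discrete-IVT count-step count-0 (m * M) count-large

    t = proj₁ target

    -- All differences are doubled, so that the odd new position is incongruent to the old ones.
    position′ : Fin (suc (suc n)) → ℕ
    position′ Fin.zero    = suc (2 * (p₀ + t))
    position′ (Fin.suc b) = 2 * p b

    new-gap : ∀ b → suc (2 * (p₀ + t)) ∸ 2 * p b ≡ suc (2 * (gap b + t))
    new-gap b = begin
      suc (2 * (p₀ + t)) ∸ 2 * p b    ≡⟨ ℕ.+-∸-assoc 1 (ℕ.*-monoʳ-≤ 2 (ℕ.≤-trans (position≤first C b) (ℕ.m≤m+n p₀ t))) ⟩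
      suc (2 * (p₀ + t) ∸ 2 * p b)    ≡⟨ ≡.cong suc (ℕ.*-distribˡ-∸ 2 (p₀ + t) (p b)) ⟨
      suc (2 * (p₀ + t ∸ p b))        ≡⟨ ≡.cong (λ z → suc (2 * z)) (ℕ.+-∸-comm t (position≤first C b)) ⟩
      suc (2 * (gap b + t))           ∎
      where open ≡.≡-Reasoning

    instance
      2M≢0 : NonZero (2 * M)
      2M≢0 = ℕ.m*n≢0 2 M

    extension : Configuration rows
    extension = record
      { scale       = 2 * M
      ; position    = position′
      ; antitone    = antitone′
      ; incongruent = incongruent′
      ; row-sum     = row-sum′
      }
      where
      open ≡.≡-Reasoning
      antitone′ : ∀ {a b} → a Fin.< b → position′ b < position′ a
      antitone′ {Fin.zero}  {Fin.suc b} _   = ℕ.s≤s (ℕ.*-monoʳ-≤ 2 (ℕ.≤-trans (position≤first C b) (ℕ.m≤m+n p₀ t)))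
      antitone′ {Fin.suc a} {Fin.suc b} a<b = ℕ.*-monoʳ-< 2 (antitone C (ℕ.s<s⁻¹ a<b))
      incongruent′ : ∀ {a b} → a Fin.< b → ¬ 2 * M ∣ position′ a ∸ position′ b
      incongruent′ {Fin.zero}  {Fin.suc b} _   div =
        2∤odd (gap b + t) (∣-trans (m∣m*n M) (≡.subst (2 * M ∣_) (new-gap b) div))
      incongruent′ {Fin.suc a} {Fin.suc b} a<b div =
        incongruent C (ℕ.s<s⁻¹ a<b) (*-cancelˡ-∣ 2 (≡.subst (2 * M ∣_) (≡.sym (ℕ.*-distribˡ-∸ 2 (p a) (p b))) div))
      row-sum′ : ∀ i → sum (λ j → m ⊓ ((position′ (inject₁ i) ∸ 2 * p j) / (2 * M))) ≡ rows i
      row-sum′ Fin.zero = begin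
        sum (λ b → m ⊓ ((suc (2 * (p₀ + t)) ∸ 2 * p b) / (2 * M)))
          ≡⟨ sum-cong-≗ (λ b → ≡.cong (m ⊓_) (≡.trans (/-congˡ (new-gap b)) (odd-quotient (gap b + t) M))) ⟩
        count t          ≡⟨ proj₂ target ⟩
        rows Fin.zero    ∎
      row-sum′ (Fin.suc i) = begin
        sum (λ b → m ⊓ ((2 * p (inject₁ i) ∸ 2 * p b) / (2 * M)))
          ≡⟨ sum-cong-≗ (λ b → ≡.cong (m ⊓_) (≡.trans (/-congˡ (≡.sym (ℕ.*-distribˡ-∸ 2 (p (inject₁ i)) (p b)))) (m*n/m*o≡n/o 2 (p (inject₁ i) ∸ p b) M))) ⟩
        m ⊓ ((p (inject₁ i) ∸ p₀) / M) + sum (λ j → m ⊓ ((p (inject₁ i) ∸ p (Fin.suc j)) / M))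
          -- The column of the old first point lies before the diagonal of an old row, so it adds
          -- zero.
          ≡⟨ ≡.cong₂ _+_ (truncated-0 M (ℕ.m≤n⇒m∸n≡0 (position≤first C (inject₁ i)))) (row-sum C i) ⟩
        rows (Fin.suc i) ∎

  -- Rows are realised from the last to the first, since row `i` involves only the points from `i`
  -- on and a point added at the head leaves the later rows intact.
  configuration : ∀ {n} {rows : Fin n → ℕ} →
    (∀ {i j} → i Fin.≤ j → rows j ≤ rows i) → (∀ i → rows i ≤ (n ∸ toℕ i) * m) → Configuration rows
  configuration {zero} _ _ = record
    { scale = 1 ; position = λ _ → 0 ; antitone = λ { {Fin.zero} {Fin.zero} () }
    ; incongruent = λ { {Fin.zero} {Fin.zero} () } ; row-sum = λ () }
  configuration {suc n} decreasing bounded =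
    Extend.extension (configuration (λ i≤j → decreasing (ℕ.s≤s i≤j)) (bounded ∘ Fin.suc)) decreasing (bounded Fin.zero)

-- Every increasing pair of coordinate indices comes from a positive root: the smaller is not the
-- last index, the larger not the first.
fin-between : ∀ {n} {a b : Fin (suc n)} → a Fin.< b →
  ∃[ i ] ∃[ j ] (inject₁ i ≡ a × Fin.suc j ≡ b × i Fin.≤ j)
fin-between {n} {a} {Fin.suc j} a<b =
  i , j , Fin.toℕ-injective (≡.trans (Fin.toℕ-inject₁ i) toℕ-i) , ≡.refl , ≡.subst (ℕ._≤ toℕ j) (≡.sym toℕ-i) (ℕ.s≤s⁻¹ a<b)
  where
  a<n : toℕ a ℕ.< n
  a<n = ℕ.≤-<-trans (ℕ.s≤s⁻¹ a<b) (Fin.toℕ<n j)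
  i : Fin n
  i = Fin.fromℕ< a<n
  toℕ-i : toℕ i ≡ toℕ a
  toℕ-i = Fin.toℕ-fromℕ< a<n

-- Cells of the arrangement and dominant regions.

module Cells (ℝ : RealNumbers) (n m : ℕ) where

  open RealNumbers ℝ hiding (zero)
  open OrderedField ℝ
  open Geometry ℝ n
  open Catalan ℝ n m
  open PositiveRoot using () renaming (i to first; j to last)

  Address : Set
  Address = PositiveRoot → ℕ

  -- There is no upper bound at level `m`, because the arrangement has no hyperplane beyond it.
  Cell : Address → Pred V 0ℓ
  Cell K v = ∀ α → fromℕ (K α) < pairing v α × (K α ℕ.< m → pairing v α < fromℕ (suc (K α)))

  Bounded : Address → Set
  Bounded K = ∀ α → K α ℕ.≤ m

  cell-convex : ∀ {K} x y t → x ∈ Cell K → y ∈ Cell K → 0# ≤ t → t ≤ 1# → segment x y t ∈ Cell K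
  cell-convex x y t x∈ y∈ 0≤t t≤1 α =
    segment-above {x} {y} {t} {α} 0≤t t≤1 (proj₁ (x∈ α)) (proj₁ (y∈ α)) ,
    λ K<m → segment-below {x} {y} {t} {α} 0≤t t≤1 (proj₂ (x∈ α) K<m) (proj₂ (y∈ α) K<m)

  cell-positive : ∀ {K} x → x ∈ Cell K → ∀ α → 0# < pairing x α
  cell-positive {K} x x∈ α = ≤-<-trans (0≤fromℕ (K α)) (proj₁ (x∈ α))

  -- If `K α` were below `d`, it would be below `m`, so the upper bound of the cell would keep the
  -- pairing under `d`.
  address-≥ : ∀ {K} x α {d} → x ∈ Cell K → d ℕ.≤ m → fromℕ d < pairing x α → d ℕ.≤ K α
  address-≥ {K} x α {d} x∈ d≤m d<x = ℕ.≮⇒≥ λ K<d →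
    <-asym d<x (<-≤-trans (proj₂ (x∈ α) (ℕ.<-≤-trans K<d d≤m)) (fromℕ-mono-≤ K<d))

  address-< : ∀ {K} x α {d} → x ∈ Cell K → pairing x α < fromℕ d → K α ℕ.< d
  address-< x α x∈ x<d = fromℕ-cancel-< (<-trans (proj₁ (x∈ α)) x<d)

  address-mono : ∀ {K K′} x y α β → Bounded K → x ∈ Cell K → y ∈ Cell K′ →
    pairing x α ≤ pairing y β → K α ℕ.≤ K′ β
  address-mono x y α β K≤m x∈ y∈ x≤y = address-≥ y β y∈ (K≤m α) (<-≤-trans (proj₁ (x∈ α)) x≤y)

  address-unique : ∀ {K K′} x → Bounded K → Bounded K′ → x ∈ Cell K → x ∈ Cell K′ → ∀ α → K α ≡ K′ α
  address-unique x K≤m K′≤m x∈ x∈′ α =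
    ℕ.≤-antisym (address-mono x x α α K≤m x∈ x∈′ ≤-refl) (address-mono x x α α K′≤m x∈′ x∈ ≤-refl)

  cell⊆complement : ∀ {K} → Cell K ⊆ complement
  cell⊆complement {K} {x} x∈ α k k≤m = [ above , below ]′ (ℕ.≤-<-connex k (K α))
    where
    above : k ℕ.≤ K α → pairing x α # fromℕ k
    above k≤K = #-sym (<⇒# (≤-<-trans (fromℕ-mono-≤ k≤K) (proj₁ (x∈ α))))
    below : K α ℕ.< k → pairing x α # fromℕ k
    below K<k = <⇒# (<-≤-trans (proj₂ (x∈ α) (ℕ.<-≤-trans K<k k≤m)) (fromℕ-mono-≤ K<k))

  -- The open half-spaces on the two sides of a hyperplane of the arrangement are disjoint and cover
  -- the complement, so a connected set cannot meet both.
  connected-avoids : ∀ {D} → D ⊆ complement → IsConnected D → ∀ {x y} α {k} → k ℕ.≤ m →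
    x ∈ D → y ∈ D → x ∈ Above α k → ¬ y ∈ Below α k
  connected-avoids {D} D⊆ connected {x} {y} α {k} k≤m x∈ y∈ k<x y<k =
    let (_ , _ , above , below) = connected (Above α k) (Below α k) (λ {z} → above-open α k {z}) (λ {z} → below-open α k {z})
          (λ z∈ → [ inj₂ , inj₁ ]′ (#⇒<⊎> (D⊆ z∈ α k k≤m))) (x , x∈ , k<x) (y , y∈ , y<k)
    in <-asym above below

  -- All bounds defining the cell are hyperplanes of the arrangement, none of which `D` can cross.
  component⊆cell : ∀ {D K} → D ⊆ complement → IsConnected D → Bounded K →
    ∀ {x} → x ∈ D → x ∈ Cell K → D ⊆ Cell K
  component⊆cell {D} {K} D⊆ connected K≤m {x} x∈D x∈ {y} y∈D α = lower , upper
    where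
    lower : fromℕ (K α) < pairing y α
    lower = [ (λ y<K → contradiction y<K (connected-avoids D⊆ connected α (K≤m α) x∈D y∈D (proj₁ (x∈ α)))) , (λ K<y → K<y) ]′
      (#⇒<⊎> (D⊆ y∈D α (K α) (K≤m α)))
    upper : K α ℕ.< m → pairing y α < fromℕ (suc (K α))
    upper K<m = [ (λ y<K → y<K) , (λ K<y → contradiction (proj₂ (x∈ α) K<m) (connected-avoids D⊆ connected α K<m y∈D x∈D K<y)) ]′
      (#⇒<⊎> (D⊆ y∈D α (suc (K α)) K<m))

  -- A floor truncated at `l`. It is computable here because apartness decides the comparison with
  -- each of the finitely many levels.
  locate : ∀ l p → 0# < p → (∀ k → k ℕ.≤ l → p # fromℕ k) →
    ∃[ k ] (k ℕ.≤ l × fromℕ k < p × (k ℕ.< l → p < fromℕ (suc k)))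
  locate zero    p 0<p apart = 0 , ℕ.z≤n , 0<p , λ ()
  locate (suc l) p 0<p apart =
    let (k , k≤l , k<p , p<1+k) = locate l p 0<p (λ k k≤l → apart k (ℕ.m≤n⇒m≤1+n k≤l))
    in [ (λ p<1+l → k , ℕ.m≤n⇒m≤1+n k≤l , k<p , λ _ →
           [ p<1+k , (λ k≡l → ≡.subst (λ j → p < fromℕ (suc j)) (≡.sym k≡l) p<1+l) ]′ (ℕ.m≤n⇒m<n∨m≡n k≤l))
       , (λ 1+l<p → suc l , ℕ.≤-refl , 1+l<p , λ l<l → contradiction l<l (ℕ.<-irrefl ≡.refl))
       ]′ (#⇒<⊎> (apart (suc l) ℕ.≤-refl))

  module Region (R : DominantRegion) where

    open IsConnectedComponent (isComponent R)

    witness : V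
    witness = proj₁ nonempty

    witness∈R : witness ∈ points R
    witness∈R = proj₂ nonempty

    located : ∀ α → ∃[ k ] (k ℕ.≤ m × fromℕ k < pairing witness α × (k ℕ.< m → pairing witness α < fromℕ (suc k)))
    located α = locate m (pairing witness α)
      ([ (λ p<0 → contradiction p<0 (dominant R witness∈R α)) , (λ 0<p → 0<p) ]′ (#⇒<⊎> (contained witness∈R α 0 ℕ.z≤n)))
      (contained witness∈R α)

    opaque
      address : Address
      address α = proj₁ (located α)

      address-bounded : Bounded address
      address-bounded α = proj₁ (proj₂ (located α))

      witness∈cell : witness ∈ Cell address
      witness∈cell α = proj₂ (proj₂ (located α))

    region⊆cell : points R ⊆ Cell address
    region⊆cell {y} = component⊆cell contained connected address-bounded {witness} witness∈R witness∈cell {y}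

    -- The cell is a connected subset of the complement containing the region, so maximality
    -- applies.
    cell⊆region : Cell address ⊆ points R
    cell⊆region = maximal (Cell address) (λ {y} → cell⊆complement {address} {y}) (convex⇒connected cell-convex) region⊆cell

  open Region public using (address; address-bounded; region⊆cell; cell⊆region; witness; witness∈R; witness∈cell)

  cellRegion : ∀ {K} → Bounded K → Satisfiable (Cell K) → DominantRegion
  cellRegion {K} K≤m (x , x∈) = record
    { points      = Cell K
    ; isComponent = record
      { nonempty  = x , x∈
      ; contained = λ {y} → cell⊆complement {K} {y}
      ; connected = convex⇒connected cell-convex
      ; maximal   = λ D D⊆ connected cell⊆D → λ {y} → component⊆cell D⊆ connected K≤m {x} (cell⊆D x∈) x∈ {y}
      }
    ; dominant    = λ {y} y∈ α → <⇒≤ (cell-positive y y∈ α)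
    }

  address-of-point : ∀ {K} x (R : DominantRegion) → Bounded K → x ∈ points R → x ∈ Cell K → ∀ α → address R α ≡ K α
  address-of-point x R K≤m x∈R x∈ = address-unique x (address-bounded R) K≤m (region⊆cell R {x} x∈R) x∈

  cell-respects : ∀ {K K′} → (∀ α → K α ≡ K′ α) → Cell K ⊆ Cell K′
  cell-respects K≡K′ {x} x∈ α = ≡.subst (λ k → fromℕ k < pairing x α × (k ℕ.< m → pairing x α < fromℕ (suc k))) (K≡K′ α) (x∈ α)

  region-≐ : ∀ (R R′ : DominantRegion) → (∀ α → address R α ≡ address R′ α) → points R ≐ points R′
  region-≐ R R′ eq =
    (λ {x} x∈ → cell⊆region R′ {x} (cell-respects eq {x} (region⊆cell R {x} x∈))) ,
    (λ {x} x∈ → cell⊆region R {x} (cell-respects (≡.sym ∘ eq) {x} (region⊆cell R′ {x} x∈)))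

  cell-antitone : ∀ {K} x {a b} → x ∈ Cell K → a Fin.< b → coord x b < coord x a
  cell-antitone {K} x {a} {b} x∈ a<b = let (i , j , i≡a , j≡b , i≤j) = fin-between a<b in
    ≡.subst₂ (λ a b → coord x b < coord x a) i≡a j≡b
      (<-from (cell-positive x x∈ (mkRoot i j i≤j)) (pairing-difference x (mkRoot i j i≤j)))

  cell-weakly-antitone : ∀ {K} x {a b} → x ∈ Cell K → a Fin.≤ b → coord x b ≤ coord x a
  cell-weakly-antitone {K} x {a} {b} x∈ a≤b = [ (λ a<b → <⇒≤ (cell-antitone x x∈ a<b)) ,
    (λ a≡b → ≈⇒≤ (reflexive (≡.cong (coord x) (Fin.toℕ-injective (≡.sym a≡b))))) ]′ (ℕ.m≤n⇒m<n∨m≡n a≤b)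

  -- Row sums of an address.

  entry-dec : Address → ∀ i j → Dec (i Fin.≤ j) → ℕ
  entry-dec K i j (yes i≤j) = K (mkRoot i j i≤j)
  entry-dec K i j (no _)    = 0

  -- Padding with zeros before the diagonal lets a row sum range over all columns. The decision is
  -- an argument of `entry-dec` so that proofs can split on it.
  entry : Address → Fin n → Fin n → ℕ
  entry K i j = entry-dec K i j (i Fin.≤? j)

  rowSum : Address → Fin n → ℕ
  rowSum K i = NaturalSums.sum (entry K i)

  entry-≤ : ∀ K {i j} (i≤j : i Fin.≤ j) → entry K i j ≡ K (mkRoot i j i≤j)
  entry-≤ K {i} {j} i≤j = go (i Fin.≤? j)
    where
    go : ∀ d → entry-dec K i j d ≡ K (mkRoot i j i≤j)
    go (yes p) = ≡.cong (λ p → K (mkRoot i j p)) (ℕ.≤-irrelevant p i≤j)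
    go (no ¬p) = contradiction i≤j ¬p

  entry-> : ∀ K {i j} → ¬ i Fin.≤ j → entry K i j ≡ 0
  entry-> K {i} {j} i≰j = go (i Fin.≤? j)
    where
    go : ∀ d → entry-dec K i j d ≡ 0
    go (yes p) = contradiction p i≰j
    go (no _)  = ≡.refl

  entry-cases : ∀ K i j → (∃[ i≤j ] entry K i j ≡ K (mkRoot i j i≤j)) ⊎ (¬ i Fin.≤ j × entry K i j ≡ 0)
  entry-cases K i j = go (i Fin.≤? j)
    where
    go : Dec (i Fin.≤ j) → (∃[ i≤j ] entry K i j ≡ K (mkRoot i j i≤j)) ⊎ (¬ i Fin.≤ j × entry K i j ≡ 0)
    go (yes p) = inj₁ (p , entry-≤ K p)
    go (no ¬p) = inj₂ (¬p , entry-> K ¬p)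

  entry-cong : ∀ {K K′} → (∀ α → K α ≡ K′ α) → ∀ i j → entry K i j ≡ entry K′ i j
  entry-cong {K} {K′} eq i j = go (i Fin.≤? j)
    where
    go : ∀ d → entry-dec K i j d ≡ entry-dec K′ i j d
    go (yes p) = eq (mkRoot i j p)
    go (no _)  = ≡.refl

  rowSum-cong : ∀ {K K′} → (∀ α → K α ≡ K′ α) → ∀ i → rowSum K i ≡ rowSum K′ i
  rowSum-cong eq i = NaturalSums.sum-cong-≗ (entry-cong eq i)

  entry-bounded : ∀ {K} → Bounded K → ∀ i j → entry K i j ℕ.≤ m
  entry-bounded {K} K≤m i j = [ (λ (_ , eq) → ≡.subst (ℕ._≤ m) (≡.sym eq) (K≤m _)) ,
    (λ (_ , eq) → ≡.subst (ℕ._≤ m) (≡.sym eq) ℕ.z≤n) ]′ (entry-cases K i j)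

  entry-before : ∀ K i j → j Fin.< i → entry K i j ≡ 0
  entry-before K i j j<i = entry-> K (ℕ.<⇒≱ j<i)

  inject₁-≤ : ∀ {i j : Fin n} → i Fin.≤ j → inject₁ i Fin.≤ inject₁ j
  inject₁-≤ {i} {j} = ≡.subst₂ ℕ._≤_ (≡.sym (Fin.toℕ-inject₁ i)) (≡.sym (Fin.toℕ-inject₁ j))

  inject₁-< : ∀ {i j : Fin n} → i Fin.< j → inject₁ i Fin.< inject₁ j
  inject₁-< {i} {j} = ≡.subst₂ ℕ._<_ (≡.sym (Fin.toℕ-inject₁ i)) (≡.sym (Fin.toℕ-inject₁ j))

  pairing-gap : ∀ x α β → (coord x (inject₁ (first β)) - coord x (inject₁ (first α))) +
    (coord x (Fin.suc (last α)) - coord x (Fin.suc (last β))) ≈ pairing x β - pairing x α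
  pairing-gap x α β = trans
    (solve 4 (λ a b c d → (a :- b) :+ (c :- d) := (a :- d) :- (b :- c)) refl _ _ _ _)
    (sym (+-cong (pairing-difference x β) (-‿cong (pairing-difference x α))))

  -- Enlarging the support of a root adds simple roots, whose pairings are positive on a cell.
  pairing-antitone : ∀ {K} x α β → x ∈ Cell K → first β Fin.≤ first α → last α Fin.≤ last β → pairing x α ≤ pairing x β
  pairing-antitone x α β x∈ i≤ j≤ = ≤-from
    (+-nonneg
      (nonneg-difference (cell-weakly-antitone x x∈ (inject₁-≤ i≤)))
      (nonneg-difference (cell-weakly-antitone x x∈ (ℕ.s≤s j≤))))
    (pairing-gap x α β)

  pairing-strictly-antitone : ∀ {K} x α β → x ∈ Cell K → first β Fin.≤ first α → last α Fin.≤ last β →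
    first β Fin.< first α ⊎ last α Fin.< last β → pairing x α < pairing x β
  pairing-strictly-antitone x α β x∈ i≤ j≤ strict = <-from
    ([ (λ i< → +-pos-nonneg (positive-difference (cell-antitone x x∈ (inject₁-< i<)))
                 (nonneg-difference (cell-weakly-antitone x x∈ (ℕ.s≤s j≤))))
     , (λ j< → <-respʳ (+-comm _ _) (+-pos-nonneg (positive-difference (cell-antitone x x∈ (ℕ.s<s j<)))
                 (nonneg-difference (cell-weakly-antitone x x∈ (inject₁-≤ i≤)))))
     ]′ strict)
    (pairing-gap x α β)

  -- In each column the root of row `i` has larger support than that of row `j`, so the entries
  -- compare columnwise.
  rowSum-decreasing : ∀ {K} x → Bounded K → x ∈ Cell K → ∀ i j → i Fin.≤ j → rowSum K j ℕ.≤ rowSum K i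
  rowSum-decreasing {K} x K≤m x∈ i j i≤j = NaturalSums.sum-mono-≤ λ l →
    [ (λ (j≤l , eq) → ≡.subst₂ ℕ._≤_ (≡.sym eq) (≡.sym (entry-≤ K (Fin.≤-trans i≤j j≤l)))
        (address-mono x x (mkRoot j l j≤l) (mkRoot i l (Fin.≤-trans i≤j j≤l)) K≤m x∈ x∈
          (pairing-antitone x (mkRoot j l j≤l) (mkRoot i l (Fin.≤-trans i≤j j≤l)) x∈ i≤j ℕ.≤-refl)))
    , (λ (_ , eq) → ≡.subst (ℕ._≤ entry K i l) (≡.sym eq) ℕ.z≤n)
    ]′ (entry-cases K j l)

  rowSum-bounded : ∀ {K} → Bounded K → ∀ i → rowSum K i ℕ.≤ (n ℕ.∸ toℕ i) ℕ.* m
  rowSum-bounded {K} K≤m i = NaturalSums.sum-tail-≤ i (entry-before K i) (entry-bounded K≤m i)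

  -- The threshold separating the two pairings is d − c.
  same-side : ∀ {K K′ c d} x y α → x ∈ Cell K → y ∈ Cell K′ → K α ≡ K′ α → d ℕ.≤ m →
    pairing x α + fromℕ c < fromℕ d → ¬ fromℕ d < pairing y α + fromℕ c
  same-side {K} {K′} {c} {d} x y α x∈ y∈ eq d≤m x+c<d d<y+c = ℕ.<⇒≱ K<e (≡.subst (e ℕ.≤_) (≡.sym eq) e≤K′)
    where
    e = d ℕ.∸ c
    c<d : fromℕ c < fromℕ d
    c<d = <-trans (<-from (cell-positive x x∈ α) (solve 2 (λ p c → p := (p :+ c) :- c) refl (pairing x α) (fromℕ c))) x+c<d
    e≈ : fromℕ e ≈ fromℕ d - fromℕ c
    e≈ = fromℕ-∸ {c} {d} (ℕ.<⇒≤ (fromℕ-cancel-< c<d))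
    K<e : K α ℕ.< e
    K<e = address-< x α x∈ (<-respʳ (sym e≈) (<-from (positive-difference x+c<d)
      (solve 3 (λ p c d → d :- (p :+ c) := (d :- c) :- p) refl (pairing x α) (fromℕ c) (fromℕ d))))
    e≤K′ : e ℕ.≤ K′ α
    e≤K′ = address-≥ y α y∈ (ℕ.≤-trans (ℕ.m∸n≤m d c) d≤m) (<-respˡ (sym e≈) (<-from (positive-difference d<y+c)
      (solve 3 (λ p c d → (p :+ c) :- d := p :- (d :- c)) refl (pairing y α) (fromℕ c) (fromℕ d))))

  -- Recovery of an address from its row sums.

  module RowComparison {K K′} (K≤m : Bounded K) (K′≤m : Bounded K′) (x y : V) (x∈ : x ∈ Cell K) (y∈ : y ∈ Cell K′)
    (i : Fin n) (lower-rows : ∀ i′ → i Fin.< i′ → ∀ j i′≤j → K (mkRoot i′ j i′≤j) ≡ K′ (mkRoot i′ j i′≤j)) where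

    -- A difference of two roots in row i is, up to sign, a root in a lower row.
    between : ∀ j j′ → i Fin.≤ j → j Fin.< j′ → ∃[ α ] (inject₁ (first α) ≡ Fin.suc j × last α ≡ j′ × K α ≡ K′ α)
    between j j′ i≤j j<j′ =
      mkRoot i′ j′ i′≤j′ , Fin.toℕ-injective (≡.trans (Fin.toℕ-inject₁ i′) toℕ-i′) , ≡.refl ,
      lower-rows i′ (ℕ.≤-<-trans i≤j (ℕ.≤-reflexive (≡.sym toℕ-i′))) j′ i′≤j′
      where
      1+j<n : suc (toℕ j) ℕ.< n
      1+j<n = ℕ.≤-<-trans j<j′ (Fin.toℕ<n j′)
      i′ : Fin n
      i′ = Fin.fromℕ< 1+j<n
      toℕ-i′ : toℕ i′ ≡ suc (toℕ j)
      toℕ-i′ = Fin.toℕ-fromℕ< 1+j<n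
      i′≤j′ : i′ Fin.≤ j′
      i′≤j′ = ≡.subst (ℕ._≤ toℕ j′) (≡.sym toℕ-i′) j<j′

    -- At `α` the level `c` separates `x` below from `y` above, at `α′` the level `c′` separates
    -- them the other way round. Subtraction puts `x` and `y` on different sides of one level for
    -- the root between the two columns, which `same-side` excludes.
    no-crossing : ∀ j j′ (i≤j : i Fin.≤ j) (i≤j′ : i Fin.≤ j′) →
      K (mkRoot i j i≤j) ℕ.< K′ (mkRoot i j i≤j) → ¬ K′ (mkRoot i j′ i≤j′) ℕ.< K (mkRoot i j′ i≤j′)
    no-crossing j j′ i≤j i≤j′ K<K′ K′<K = compare (ℕ.<-cmp (toℕ j) (toℕ j′))
      where
      α  = mkRoot i j i≤j
      α′ = mkRoot i j′ i≤j′
      c  = K′ α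
      c′ = K α′
      X Y : Fin (suc n) → Carrier
      X = coord x
      Y = coord y
      x<c : X (inject₁ i) - X (Fin.suc j) < fromℕ c
      x<c = <-respˡ (pairing-difference x α) (<-≤-trans (proj₂ (x∈ α) (ℕ.<-≤-trans K<K′ (K′≤m α))) (fromℕ-mono-≤ K<K′))
      c<y : fromℕ c < Y (inject₁ i) - Y (Fin.suc j)
      c<y = <-respʳ (pairing-difference y α) (proj₁ (y∈ α))
      c′<x : fromℕ c′ < X (inject₁ i) - X (Fin.suc j′)
      c′<x = <-respʳ (pairing-difference x α′) (proj₁ (x∈ α′))
      y<c′ : Y (inject₁ i) - Y (Fin.suc j′) < fromℕ c′
      y<c′ = <-respˡ (pairing-difference y α′) (<-≤-trans (proj₂ (y∈ α′) (ℕ.<-≤-trans K′<K (K≤m α′))) (fromℕ-mono-≤ K′<K))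
      subtract : ∀ {a b d c c′ p} → a - b < c → c′ < a - d → p ≈ d - b → p + c′ < c
      subtract {a} {b} {d} {c} {c′} a-b<c c′<a-d p≈ = <-respˡ (+-congʳ (sym p≈))
        (<-from (+-pos (positive-difference a-b<c) (positive-difference c′<a-d))
          (solve 5 (λ a b d c c′ → (c :- (a :- b)) :+ ((a :- d) :- c′) := c :- ((d :- b) :+ c′)) refl a b d c c′))
      subtract′ : ∀ {a b d c c′ p} → a - b < c → c′ < a - d → p ≈ b - d → c′ < p + c
      subtract′ {a} {b} {d} {c} {c′} a-b<c c′<a-d p≈ = <-respʳ (+-congʳ (sym p≈))
        (<-from (+-pos (positive-difference a-b<c) (positive-difference c′<a-d))
          (solve 5 (λ a b d c c′ → (c :- (a :- b)) :+ ((a :- d) :- c′) := ((b :- d) :+ c) :- c′) refl a b d c c′))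
      pairing-between : ∀ v β {a b} → inject₁ (first β) ≡ Fin.suc a → last β ≡ b → pairing v β ≈ coord v (Fin.suc a) - coord v (Fin.suc b)
      pairing-between v β a≡ b≡ = trans (pairing-difference v β)
        (reflexive (≡.cong₂ (λ p q → coord v p - coord v (Fin.suc q)) a≡ b≡))
      compare : Tri (toℕ j ℕ.< toℕ j′) (toℕ j ≡ toℕ j′) (toℕ j′ ℕ.< toℕ j) → ⊥
      compare (tri< j<j′ _ _) = let (β , a≡ , b≡ , eq) = between j j′ i≤j j<j′ in
        same-side {c = c} {c′} y x β y∈ x∈ (≡.sym eq) (K≤m α′)
          (subtract y<c′ c<y (pairing-between y β a≡ b≡)) (subtract′ x<c c′<x (pairing-between x β a≡ b≡))
      compare (tri> _ _ j′<j) = let (β , a≡ , b≡ , eq) = between j′ j i≤j′ j′<j in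
        same-side {c = c′} {c} x y β x∈ y∈ eq (K′≤m α)
          (subtract x<c c′<x (pairing-between x β a≡ b≡)) (subtract′ y<c′ c<y (pairing-between y β a≡ b≡))
      -- In a common column `x` gives `c′ < c` while `y` gives `c < c′`.
      compare (tri≈ _ j≡j′ _) = <-asym
        (<-trans (≡.subst (λ j → fromℕ c′ < X (inject₁ i) - X (Fin.suc j)) (≡.sym (Fin.toℕ-injective j≡j′)) c′<x) x<c)
        (<-trans c<y (≡.subst (λ j → Y (inject₁ i) - Y (Fin.suc j) < fromℕ c′) (≡.sym (Fin.toℕ-injective j≡j′)) y<c′))

    no-crossing-entry : ∀ {j j′} → entry K i j ℕ.< entry K′ i j → ¬ entry K′ i j′ ℕ.< entry K i j′
    no-crossing-entry {j} {j′} lt gt =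
      [ (λ (i≤j , eq′) →
          [ (λ (i≤j′ , eq) → no-crossing j j′ i≤j i≤j′
              (≡.subst₂ ℕ._<_ (entry-≤ K i≤j) eq′ lt) (≡.subst₂ ℕ._<_ (entry-≤ K′ i≤j′) eq gt))
          , (λ (_ , eq) → ℕ.n≮0 (≡.subst (entry K′ i j′ ℕ.<_) eq gt))
          ]′ (entry-cases K i j′))
      , (λ (_ , eq) → ℕ.n≮0 (≡.subst (entry K i j ℕ.<_) eq lt))
      ]′ (entry-cases K′ i j)

    -- With equal row sums, a rise in one column must be compensated by a fall in another, contrary
    -- to `no-crossing-entry`.
    row-≤ : rowSum K i ≡ rowSum K′ i → ∀ j → entry K′ i j ℕ.≤ entry K i j
    row-≤ eq j = ℕ.≮⇒≥ λ lt → no-crossing-entry lt (proj₂ (NaturalSums.sum-compensation eq j lt))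

  -- Recursion from the last row upwards; `RowComparison` is applied in both directions to get
  -- equality in each row.
  address-determined : ∀ {K K′} → Bounded K → Bounded K′ → Satisfiable (Cell K) → Satisfiable (Cell K′) →
    (∀ i → rowSum K i ≡ rowSum K′ i) → ∀ α → K α ≡ K′ α
  address-determined {K} {K′} K≤m K′≤m (x , x∈) (y , y∈) rows (mkRoot i j i≤j) = row i (Fin.>-wellFounded i) j i≤j
    where
    row : ∀ i → Acc Fin._>_ i → ∀ j i≤j → K (mkRoot i j i≤j) ≡ K′ (mkRoot i j i≤j)
    row i (acc rec) j i≤j = ≡.trans (≡.sym (entry-≤ K i≤j)) (≡.trans (ℕ.≤-antisym
      (RowComparison.row-≤ K′≤m K≤m y x y∈ x∈ i (λ i′ i<i′ j p → ≡.sym (row i′ (rec i<i′) j p)) (≡.sym (rows i)) j)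
      (RowComparison.row-≤ K≤m K′≤m x y x∈ y∈ i (λ i′ i<i′ → row i′ (rec i<i′)) (rows i) j))
      (entry-≤ K′ i≤j))

-- Points of V realising a configuration.

module Realisation (ℝ : RealNumbers) (n m : ℕ) {rows : Fin n → ℕ} (C : Configuration m rows) where

  open RealNumbers ℝ hiding (zero)
  open OrderedField ℝ
  open Geometry ℝ n
  open Catalan ℝ n m
  open Cells ℝ n m
  open PositiveRoot using () renaming (i to first; j to last)
  open Configuration C renaming (scale to M)
  open ≈-Reasoning setoid

  opaque
    M⁻¹ : Carrier
    M⁻¹ = proj₁ (pos-inverse (fromℕ-mono-< (ℕ.>-nonZero⁻¹ M)))

    0<M⁻¹ : 0# < M⁻¹
    0<M⁻¹ = proj₁ (proj₂ (pos-inverse (fromℕ-mono-< (ℕ.>-nonZero⁻¹ M))))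

    M*M⁻¹ : fromℕ M * M⁻¹ ≈ 1#
    M*M⁻¹ = proj₂ (proj₂ (pos-inverse (fromℕ-mono-< (ℕ.>-nonZero⁻¹ M))))

  height : Vector Carrier (suc n)
  height a = fromℕ (position a) * M⁻¹

  point : V
  point = centre height

  distance : Fin n → Fin n → ℕ
  distance i j = position (inject₁ i) ℕ.∸ position (Fin.suc j)

  realised : Address
  realised (mkRoot i j _) = m ℕ.⊓ (distance i j ℕ./ M)

  first<last : ∀ {i j : Fin n} → i Fin.≤ j → inject₁ i Fin.< Fin.suc j
  first<last {i} {j} i≤j = ≡.subst (ℕ._< suc (toℕ j)) (≡.sym (Fin.toℕ-inject₁ i)) (ℕ.s≤s i≤j)

  pairing-point : ∀ α → pairing point α ≈ fromℕ (distance (first α) (last α)) * M⁻¹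
  pairing-point α@(mkRoot i j i≤j) = begin
    pairing point α
      ≈⟨ pairing-centre height α ⟩
    fromℕ (position (inject₁ i)) * M⁻¹ - fromℕ (position (Fin.suc j)) * M⁻¹
      ≈⟨ solve 3 (λ a b s → a :* s :- b :* s := (a :- b) :* s) refl _ _ M⁻¹ ⟩
    (fromℕ (position (inject₁ i)) - fromℕ (position (Fin.suc j))) * M⁻¹
      ≈⟨ *-congʳ (fromℕ-∸ (ℕ.<⇒≤ (antitone (first<last i≤j)))) ⟨
    fromℕ (distance i j) * M⁻¹  ∎

  scaled : ∀ c → fromℕ (c ℕ.* M) * M⁻¹ ≈ fromℕ c
  scaled c = begin
    fromℕ (c ℕ.* M) * M⁻¹        ≈⟨ *-congʳ (fromℕ-* c M) ⟩
    fromℕ c * fromℕ M * M⁻¹      ≈⟨ *-assoc _ _ _ ⟩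
    fromℕ c * (fromℕ M * M⁻¹)    ≈⟨ *-congˡ M*M⁻¹ ⟩
    fromℕ c * 1#                 ≈⟨ *-identityʳ _ ⟩
    fromℕ c                      ∎

  *M⁻¹-mono-< : ∀ {j k} → j ℕ.< k → fromℕ j * M⁻¹ < fromℕ k * M⁻¹
  *M⁻¹-mono-< {j} {k} j<k = <-from (*-pos (positive-difference (fromℕ-mono-< j<k)) 0<M⁻¹)
    (solve 3 (λ a b s → (b :- a) :* s := b :* s :- a :* s) refl (fromℕ j) (fromℕ k) M⁻¹)

  -- The lower bound is strict because no distance is a multiple of `M`; below `m` the truncation is
  -- inactive, so the upper bound is that of the quotient.
  point∈cell : point ∈ Cell realised
  point∈cell α@(mkRoot i j i≤j) =
    <-respˡ (scaled (realised α)) (<-respʳ (sym (pairing-point α)) (*M⁻¹-mono-< (ℕ.≤∧≢⇒< kM≤d kM≢d))) ,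
    λ k<m → <-respˡ (sym (pairing-point α)) (<-respʳ (scaled (suc (realised α))) (*M⁻¹-mono-< (upper k<m)))
    where
    d = distance i j
    kM≤d : realised α ℕ.* M ℕ.≤ d
    kM≤d = Floor.quotient-≤ M (ℕ.m⊓n≤n m (d ℕ./ M))
    kM≢d : ¬ realised α ℕ.* M ≡ d
    kM≢d eq = incongruent (first<last i≤j) (divides (realised α) (≡.sym eq))
    upper : realised α ℕ.< m → d ℕ.< suc (realised α) ℕ.* M
    upper k<m = Floor.quotient-< M (ℕ.≰⇒> λ 1+k≤q → ℕ.<⇒≱ (ℕ.n<1+n _) (ℕ.⊓-glb k<m 1+k≤q))

  realised-bounded : Bounded realised
  realised-bounded (mkRoot i j _) = ℕ.m⊓n≤m m _

  realised-entry : ∀ i j → entry realised i j ≡ m ℕ.⊓ (distance i j ℕ./ M)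
  realised-entry i j = [ (λ (_ , eq) → eq) , (λ (i≰j , eq) → ≡.trans eq (≡.sym (truncated-0 m M (ℕ.m≤n⇒m∸n≡0
    (position-≤ (≡.subst (suc (toℕ j) ℕ.≤_) (≡.sym (Fin.toℕ-inject₁ i)) (ℕ.≰⇒> i≰j))))))) ]′ (entry-cases realised i j)

  realised-rows : ∀ i → rowSum realised i ≡ rows i
  realised-rows i = ≡.trans (NaturalSums.sum-cong-≗ (realised-entry i)) (row-sum i)

-- Position of the support of a root relative to a simple root.

data RootPosition {n} (a b i : Fin n) : Set where
  isSimple : a ≡ i → b ≡ i → RootPosition a b i
  contains : a Fin.≤ i → i Fin.≤ b → a Fin.< i ⊎ i Fin.< b → RootPosition a b i
  before   : a Fin.≤ i → b Fin.< i → RootPosition a b i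
  after    : i Fin.< a → i Fin.< b → RootPosition a b i

-- Moving along the coweight of `i` affects only roots whose support contains `i`. Among these the
-- simple root is kept apart, since it alone is brought onto the wall.
rootPosition : ∀ {n} (a b i : Fin n) → a Fin.≤ b → RootPosition a b i
rootPosition a b i a≤b with Fin.<-cmp a i | Fin.<-cmp b i
... | tri< a<i _ _ | tri< b<i _ _ = before (ℕ.<⇒≤ a<i) b<i
... | tri< a<i _ _ | tri≈ _ b≡i _ = contains (ℕ.<⇒≤ a<i) (ℕ.≤-reflexive (≡.cong toℕ (≡.sym b≡i))) (inj₁ a<i)
... | tri< a<i _ _ | tri> _ _ i<b = contains (ℕ.<⇒≤ a<i) (ℕ.<⇒≤ i<b) (inj₁ a<i)
... | tri≈ _ a≡i _ | tri< b<i _ _ = before (ℕ.≤-reflexive (≡.cong toℕ a≡i)) b<i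
... | tri≈ _ a≡i _ | tri≈ _ b≡i _ = isSimple a≡i b≡i
... | tri≈ _ a≡i _ | tri> _ _ i<b = contains (ℕ.≤-reflexive (≡.cong toℕ a≡i)) (ℕ.<⇒≤ i<b) (inj₂ i<b)
... | tri> _ _ i<a | _            = after i<a (ℕ.<-≤-trans i<a a≤b)

-- Facets and separating walls.

module Wall (ℝ : RealNumbers) (n m : ℕ) where

  open RealNumbers ℝ hiding (zero)
  open OrderedField ℝ
  open Sums ℝ
  open Geometry ℝ n
  open Catalan ℝ n m
  open Cells ℝ n m
  open PositiveRoot using () renaming (i to first; j to last)
  open ≈-Reasoning setoid

  -- The pairing is linear and the weights of an affine combination sum to one.
  affineHull⊆H : ∀ {S α k} → S ⊆ H α k → affineHull S ⊆ H α k
  affineHull⊆H {S} {α} {k} S⊆H {v} (l , p , c , p∈S , Σc≈1 , v≈) = begin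
    pairing v α                          ≈⟨ pairing-difference v α ⟩
    coord v a - coord v b                ≈⟨ +-cong (v≈ a) (-‿cong (v≈ b)) ⟩
    sum (λ q → c q * coord (p q) a) - sum (λ q → c q * coord (p q) b)
      ≈⟨ sum-difference c (λ q → coord (p q) a) (λ q → coord (p q) b) ⟨
    sum (λ q → c q * (coord (p q) a - coord (p q) b))
      ≈⟨ sum-cong-≋ (λ q → *-congˡ (trans (sym (pairing-difference (p q) α)) (S⊆H (p∈S q)))) ⟩
    sum (λ q → c q * fromℕ k)            ≈⟨ *-distribʳ-sum (fromℕ k) c ⟨
    sum c * fromℕ k                      ≈⟨ *-congʳ Σc≈1 ⟩
    1# * fromℕ k                         ≈⟨ *-identityˡ _ ⟩
    fromℕ k                              ∎
    where
    a = inject₁ (first α)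
    b = Fin.suc (last α)

  -- A point strictly below the level has a ball below it, and that ball would meet `S`.
  closure-atLeast : ∀ {S α k} → S ⊆ Above α k → closure S ⊆ AtLeast α k
  closure-atLeast {S} {α} {k} S⊆ {v} v∈ v<k =
    let (δ , 0<δ , ball⊆) = below-open α k {v} v<k
        (z , z∈S , near)  = v∈ δ 0<δ
    in <-asym (S⊆ {z} z∈S) (ball⊆ {z} near)

  -- Positive roots are finite in number: they are reached through all index pairs, and the order
  -- proof in a root is irrelevant.
  Eventually-roots : {P : PositiveRoot → ℕ → Set} → (∀ α → Eventually (P α)) → Eventually (λ k → ∀ α → P α k)
  Eventually-roots {P} ev = let (N , all) = Eventually-∀ (λ i → Eventually-∀ (λ j → at i j (i Fin.≤? j))) in
    N , λ k N≤k (mkRoot i j i≤j) → all k N≤k i j i≤j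
    where
    at : ∀ i j → Dec (i Fin.≤ j) → Eventually (λ k → ∀ i≤j → P (mkRoot i j i≤j) k)
    at i j (yes p) = let (N , all) = ev (mkRoot i j p) in
      N , λ k N≤k i≤j → ≡.subst (λ p → P (mkRoot i j p) k) (ℕ.≤-irrelevant p i≤j) (all k N≤k)
    at i j (no ¬p) = Eventually-const (λ k i≤j → contradiction i≤j ¬p)

  module Facet {K} (i : Fin n) (x : V) (x∈ : x ∈ Cell K) (K≤m : Bounded K) (Kᵢ≡m : K (simple i) ≡ m) where

    m<x : fromℕ m < pairing x (simple i)
    m<x = ≡.subst (λ k → fromℕ k < pairing x (simple i)) Kᵢ≡m (proj₁ (x∈ (simple i)))

    -- The relative interior of the facet of the cell on the hyperplane of the simple root.
    OnFacet : Pred V 0ℓ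
    OnFacet v = pairing v (simple i) ≈ fromℕ m × (∀ α →
      (α ≡ simple i ⊎ fromℕ (K α) < pairing v α) × (K α ℕ.< m → pairing v α < fromℕ (suc (K α))))

    module _ {v} (v∈ : OnFacet v) where

      -- Strict bounds persist by convexity, and equality at the simple root turns strict because
      -- `x` lies above level `m`.
      towards : ∀ k → segment v x (inv k) ∈ Cell K
      towards k α = [ at-simple , (λ K<v → segment-above {v} {x} {inv k} {α} (<⇒≤ (0<inv k)) (inv≤1 k) K<v (proj₁ (x∈ α))) ]′ (proj₁ (proj₂ v∈ α)) ,
        λ K<m → segment-below {v} {x} {inv k} {α} (<⇒≤ (0<inv k)) (inv≤1 k) (proj₂ (proj₂ v∈ α) K<m) (proj₂ (x∈ α) K<m)
        where
        simple-case : fromℕ m < pairing (segment v x (inv k)) (simple i)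
        simple-case = <-respʳ (sym (trans (pairing-segment v x (inv k) (simple i)) (+-congʳ (*-congˡ (proj₁ v∈)))))
          (<-from (*-pos (0<inv k) (positive-difference m<x))
            (solve 3 (λ t m p → t :* (p :- m) := ((con (+ 1) :- t) :* m :+ t :* p) :- m) refl (inv k) (fromℕ m) (pairing x (simple i))))
        at-simple : α ≡ simple i → fromℕ (K α) < pairing (segment v x (inv k)) α
        at-simple ≡.refl = ≡.subst (λ c → fromℕ c < pairing (segment v x (inv k)) (simple i)) (≡.sym Kᵢ≡m) simple-case

      onFacet⇒closure : v ∈ closure (Cell K)
      onFacet⇒closure δ 0<δ = segment v x (inv N) , towards N , λ j →
        <-from (proj₁ (proj₂ small N ℕ.≤-refl j))
          (solve 4 (λ t a b δ → δ :+ t :* (b :- a) := (((con (+ 1) :- t) :* a :+ t :* b) :+ δ) :- a) refl (inv N) (coord v j) (coord x j) δ) ,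
        <-from (proj₂ (proj₂ small N ℕ.≤-refl j))
          (solve 4 (λ t a b δ → δ :+ t :* (:- (b :- a)) := (a :+ δ) :- ((con (+ 1) :- t) :* a :+ t :* b)) refl (inv N) (coord v j) (coord x j) δ)
        where
        small : Eventually (λ k → ∀ j → 0# < δ + inv k * (coord x j - coord v j) × 0# < δ + inv k * (- (coord x j - coord v j)))
        small = Eventually-∀ (λ j → Eventually-zip _,_ (eventually-< _ 0<δ) (eventually-< _ 0<δ))
        N : ℕ
        N = proj₁ small

    g : Carrier
    g = pairing x (simple i) - fromℕ m

    indicator-dec : ∀ {a : Fin (suc n)} → Dec (toℕ a ℕ.≤ toℕ i) → Carrier
    indicator-dec (yes _) = 1#
    indicator-dec (no _)  = 0#

    -- The fundamental coweight of the simple root, up to translation along (1, ..., 1).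
    indicator : Fin (suc n) → Carrier
    indicator a = indicator-dec {a} (toℕ a ℕ.≤? toℕ i)

    indicator-1 : ∀ a → toℕ a ℕ.≤ toℕ i → indicator a ≈ 1#
    indicator-1 a a≤i = go (toℕ a ℕ.≤? toℕ i)
      where
      go : ∀ d → indicator-dec {a} d ≈ 1#
      go (yes _) = refl
      go (no ¬p) = contradiction a≤i ¬p

    indicator-0 : ∀ a → toℕ i ℕ.< toℕ a → indicator a ≈ 0#
    indicator-0 a i<a = go (toℕ a ℕ.≤? toℕ i)
      where
      go : ∀ d → indicator-dec {a} d ≈ 0#
      go (yes p) = contradiction i<a (ℕ.≤⇒≯ p)
      go (no _)  = refl

    -- Moving x against the fundamental coweight of the simple root changes only the pairings with
    -- roots whose support contains it.
    lowered : Vector Carrier (suc n)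
    lowered a = coord x a - g * indicator a

    foot : V
    foot = centre lowered

    pairing-foot : ∀ α {p q} → indicator (inject₁ (first α)) ≈ p → indicator (Fin.suc (last α)) ≈ q →
      pairing foot α ≈ pairing x α - g * (p - q)
    pairing-foot α {p} {q} ≈p ≈q = begin
      pairing foot α                               ≈⟨ pairing-centre lowered α ⟩
      (X a - g * indicator a) - (X b - g * indicator b)
        ≈⟨ +-cong (+-congˡ (-‿cong (*-congˡ ≈p))) (-‿cong (+-congˡ (-‿cong (*-congˡ ≈q)))) ⟩
      (X a - g * p) - (X b - g * q)
        ≈⟨ solve 5 (λ a b g p q → (a :- g :* p) :- (b :- g :* q) := (a :- b) :- g :* (p :- q)) refl (X a) (X b) g p q ⟩
      X a - X b - g * (p - q)                      ≈⟨ +-congʳ (pairing-difference x α) ⟨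
      pairing x α - g * (p - q)                    ∎
      where
      X = coord x
      a = inject₁ (first α)
      b = Fin.suc (last α)

    foot-inside : ∀ α → first α Fin.≤ i → i Fin.≤ last α → pairing foot α ≈ pairing x α - g
    foot-inside α a≤i i≤b = trans
      (pairing-foot α (indicator-1 _ (≡.subst (ℕ._≤ toℕ i) (≡.sym (Fin.toℕ-inject₁ (first α))) a≤i)) (indicator-0 _ (ℕ.s≤s i≤b)))
      (solve 2 (λ p g → p :- g :* (con (+ 1) :- con (+ 0)) := p :- g) refl (pairing x α) g)

    foot-before : ∀ α → first α Fin.≤ i → last α Fin.< i → pairing foot α ≈ pairing x α
    foot-before α a≤i b<i = trans
      (pairing-foot α (indicator-1 _ (≡.subst (ℕ._≤ toℕ i) (≡.sym (Fin.toℕ-inject₁ (first α))) a≤i)) (indicator-1 _ b<i))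
      (solve 2 (λ p g → p :- g :* (con (+ 1) :- con (+ 1)) := p) refl (pairing x α) g)

    foot-after : ∀ α → i Fin.< first α → i Fin.< last α → pairing foot α ≈ pairing x α
    foot-after α i<a i<b = trans
      (pairing-foot α (indicator-0 _ (≡.subst (toℕ i ℕ.<_) (≡.sym (Fin.toℕ-inject₁ (first α))) i<a)) (indicator-0 _ (ℕ.m≤n⇒m≤1+n i<b)))
      (solve 2 (λ p g → p :- g :* (con (+ 0) :- con (+ 0)) := p) refl (pairing x α) g)

    -- A root whose support properly contains `i` has a larger pairing than the simple root, so
    -- lowering by `g` leaves it above `m`; lowering also respects upper bounds. The other roots
    -- keep their pairings.
    foot∈ : OnFacet foot
    foot∈ = trans (foot-inside (simple i) ℕ.≤-refl ℕ.≤-refl)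
        (solve 2 (λ p m → p :- (p :- m) := m) refl (pairing x (simple i)) (fromℕ m)) ,
      λ α → by-position α (rootPosition (first α) (last α) i (PositiveRoot.i≤j α))
      where
      Constraint : PositiveRoot → Set
      Constraint α = (α ≡ simple i ⊎ fromℕ (K α) < pairing foot α) × (K α ℕ.< m → pairing foot α < fromℕ (suc (K α)))
      unchanged : ∀ α → pairing foot α ≈ pairing x α → Constraint α
      unchanged α eq = inj₂ (<-respʳ (sym eq) (proj₁ (x∈ α))) , λ K<m → <-respˡ (sym eq) (proj₂ (x∈ α) K<m)
      by-position : ∀ α → RootPosition (first α) (last α) i → Constraint α
      by-position (mkRoot _ _ p) (isSimple ≡.refl ≡.refl) = inj₁ (≡.cong (mkRoot i i) (ℕ.≤-irrelevant p ℕ.≤-refl)) ,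
        -- At the simple root saturation contradicts `K<m`.
        λ K<m → contradiction (≡.trans (≡.cong (λ p → K (mkRoot i i p)) (ℕ.≤-irrelevant p ℕ.≤-refl)) Kᵢ≡m) (ℕ.<⇒≢ K<m)
      by-position α (contains a≤i i≤b strict) = inj₂ (≤-<-trans (fromℕ-mono-≤ (K≤m α)) (<-respʳ (sym (foot-inside α a≤i i≤b))
          (<-from (positive-difference (pairing-strictly-antitone x (simple i) α x∈ a≤i i≤b strict))
            (solve 3 (λ p q m → q :- p := (q :- (p :- m)) :- m) refl (pairing x (simple i)) (pairing x α) (fromℕ m))))) ,
        λ K<m → <-trans (<-respˡ (sym (foot-inside α a≤i i≤b)) (<-from (positive-difference m<x)
            (solve 2 (λ p g → g := p :- (p :- g)) refl (pairing x α) g))) (proj₂ (x∈ α) K<m)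
      by-position α (before a≤i b<i) = unchanged α (foot-before α a≤i b<i)
      by-position α (after i<a i<b)  = unchanged α (foot-after α i<a i<b)

    module _ {v} (v∈H : v ∈ H (simple i) m) where

      move : ℕ → V
      move k = segment foot v (inv k)

      pairing-move : ∀ k α → pairing (move k) α ≈ pairing foot α + inv k * (pairing v α - pairing foot α)
      pairing-move k α = trans (pairing-segment foot v (inv k) α)
        (solve 3 (λ t p q → (con (+ 1) :- t) :* p :+ t :* q := p :+ t :* (q :- p)) refl (inv k) (pairing foot α) (pairing v α))

      Constraints : PositiveRoot → ℕ → Set
      Constraints α k = (α ≡ simple i ⊎ fromℕ (K α) < pairing (move k) α) × (K α ℕ.< m → pairing (move k) α < fromℕ (suc (K α)))

      eventually-lower : ∀ α → Eventually (λ k → α ≡ simple i ⊎ fromℕ (K α) < pairing (move k) α)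
      eventually-lower α = [ (λ eq → Eventually-const (λ _ → inj₁ eq)) , (λ K<foot →
        let (N , all) = eventually-< (pairing v α - pairing foot α) K<foot in
        N , λ k N≤k → inj₂ (<-respʳ (sym (pairing-move k α)) (all k N≤k))) ]′ (proj₁ (proj₂ foot∈ α))

      eventually-upper : ∀ α → Dec (K α ℕ.< m) → Eventually (λ k → K α ℕ.< m → pairing (move k) α < fromℕ (suc (K α)))
      eventually-upper α (no K≮m)  = Eventually-const (λ _ K<m → contradiction K<m K≮m)
      eventually-upper α (yes K<m) =
        let (N , all) = eventually-< (- (pairing v α - pairing foot α)) (proj₂ (proj₂ foot∈ α) K<m) in
        N , λ k N≤k _ → <-respˡ (sym (pairing-move k α)) (<-from (positive-difference (all k N≤k))
          (solve 4 (λ c t d f → (c :+ t :* (:- d)) :- f := c :- (f :+ t :* d)) refl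
            (fromℕ (suc (K α))) (inv k) (pairing v α - pairing foot α) (pairing foot α)))

      -- The conditions other than the equation are finitely many strict inequalities valid at
      -- `foot`, so a small enough step towards `v` preserves them.
      eventually-onFacet : Eventually (λ k → ∀ α → Constraints α k)
      eventually-onFacet = Eventually-roots (λ α → Eventually-zip _,_ (eventually-lower α) (eventually-upper α (K α ℕ.<? m)))

      opaque
        onFacet : ∃[ k ] move k ∈ OnFacet
        onFacet = let (N , all) = eventually-onFacet in N , trans (pairing-move N (simple i)) (begin
            pairing foot (simple i) + inv N * (pairing v (simple i) - pairing foot (simple i))
              ≈⟨ +-cong (proj₁ foot∈) (*-congˡ (+-cong v∈H (-‿cong (proj₁ foot∈)))) ⟩
            fromℕ m + inv N * (fromℕ m - fromℕ m)
              ≈⟨ solve 2 (λ m t → m :+ t :* (m :- m) := m) refl (fromℕ m) (inv N) ⟩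
            fromℕ m  ∎) , all N ℕ.≤-refl

    pair : ∀ {A : Set} → A → A → Vector A 2
    pair a b Fin.zero    = a
    pair a b (Fin.suc _) = b

    -- The point `q` divides the segment from `foot` to `v` in the ratio given by `inv N`. Solving
    -- for `v` gives the weights `1# - F` and `F`, where `F` is the inverse of `inv N`.
    H⊆affineHull : ∀ {C} → Cell K ⊆ C → H (simple i) m ⊆ affineHull (closure C ∩ H (simple i) m)
    H⊆affineHull {C} cell⊆ {v} v∈H = 2 , pair foot q , pair (1# - F) F , points∈ ,
      solve 1 (λ F → (con (+ 1) :- F) :+ (F :+ con (+ 0)) := con (+ 1)) refl F , coordinates
      where
      N : ℕ
      N = proj₁ (onFacet {v} v∈H)
      q : V
      q = move {v} v∈H N
      F : Carrier
      F = fromℕ (suc N)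
      in-closure : ∀ {u} → u ∈ OnFacet → u ∈ closure C
      in-closure {u} u∈ δ 0<δ = let (z , z∈ , near) = onFacet⇒closure {u} u∈ δ 0<δ in z , cell⊆ {z} z∈ , near
      points∈ : ∀ a → pair foot q a ∈ closure C ∩ H (simple i) m
      points∈ Fin.zero    = in-closure {foot} foot∈ , proj₁ foot∈
      points∈ (Fin.suc _) = in-closure {q} (proj₂ (onFacet {v} v∈H)) , proj₁ (proj₂ (onFacet {v} v∈H))
      coordinates : ∀ j → coord v j ≈ (1# - F) * coord foot j + (F * ((1# - inv N) * coord foot j + inv N * coord v j) + 0#)
      coordinates j = begin
        coord v j                          ≈⟨ solve 2 (λ f v → v := f :+ con (+ 1) :* (v :- f)) refl (coord foot j) (coord v j) ⟩
        coord foot j + 1# * (coord v j - coord foot j)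
          ≈⟨ +-congˡ (*-congʳ (fromℕ*inv N)) ⟨
        coord foot j + F * inv N * (coord v j - coord foot j)
          ≈⟨ solve 4 (λ F t f v → f :+ F :* t :* (v :- f) := (con (+ 1) :- F) :* f :+ (F :* ((con (+ 1) :- t) :* f :+ t :* v) :+ con (+ 0)))
               refl F (inv N) (coord foot j) (coord v j) ⟩
        (1# - F) * coord foot j + (F * ((1# - inv N) * coord foot j + inv N * coord v j) + 0#) ∎

    supportsFacet : ∀ {C} → C ⊆ Cell K → Cell K ⊆ C → SupportsFacet (simple i) m C
    supportsFacet {C} ⊆cell cell⊆ =
      inj₂ (λ {v} → closure-atLeast {C} {simple i} {m} (λ {z} z∈ → ≡.subst (λ k → fromℕ k < pairing z (simple i)) Kᵢ≡m (proj₁ (⊆cell {z} z∈ (simple i)))) {v}) ,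
      (λ {v} → affineHull⊆H {closure C ∩ H (simple i) m} {simple i} {m} proj₂ {v}) ,
      (λ {v} → H⊆affineHull cell⊆ {v})

  pairing-origin : ∀ α → pairing origin α ≈ 0#
  pairing-origin α = trans (pairing-difference origin α) (solve 0 (con (+ 0) :- con (+ 0) := con (+ 0)) refl)

  module _ (R : DominantRegion) (i : Fin n) where

    private
      K = address R

    full-row⇒saturated : rowSum K i ≡ (n ℕ.∸ toℕ i) ℕ.* m → K (simple i) ≡ m
    full-row⇒saturated eq = ≡.trans (≡.sym (entry-≤ K Fin.≤-refl))
      (NaturalSums.sum-tail-max i (entry-before K i) (entry-bounded (address-bounded R) i) eq)

    -- Every root of row `i` has the simple root in its support, so its pairing also exceeds `m` and
    -- its entry is `m`.
    above⇒full-row : fromℕ m < pairing (witness R) (simple i) → rowSum K i ≡ (n ℕ.∸ toℕ i) ℕ.* m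
    above⇒full-row m<x = NaturalSums.sum-tail i (entry-before K i) λ j i≤j → ≡.trans (entry-≤ K i≤j)
      (ℕ.≤-antisym (address-bounded R _) (address-≥ (witness R) (mkRoot i j i≤j) (witness∈cell R) ℕ.≤-refl
        (<-≤-trans m<x (pairing-antitone (witness R) (simple i) (mkRoot i j i≤j) (witness∈cell R) ℕ.≤-refl i≤j))))

    wall⇒full-row : IsSeparatingWall (simple i) m R → rowSum K i ≡ (n ℕ.∸ toℕ i) ℕ.* m
    wall⇒full-row (_ , _ , separates) =
      [ (λ (R⊆above , _) → above⇒full-row (R⊆above {witness R} (witness∈R R)))
      -- The origin has pairing zero and so cannot lie above level `m`.
      , (λ (_ , m<0) → contradiction (<-respʳ (pairing-origin (simple i)) m<0) (0≤fromℕ m))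
      ]′ separates

    full-row⇒wall : 0 ℕ.< m → rowSum K i ≡ (n ℕ.∸ toℕ i) ℕ.* m → IsSeparatingWall (simple i) m R
    full-row⇒wall 0<m eq = ℕ.≤-refl ,
      Facet.supportsFacet i (witness R) (witness∈cell R) (address-bounded R) Kᵢ≡m
        (λ {v} → region⊆cell R {v}) (λ {v} → cell⊆region R {v}) ,
      inj₁ ((λ {v} v∈ → ≡.subst (λ k → fromℕ k < pairing v (simple i)) Kᵢ≡m (proj₁ (region⊆cell R {v} v∈ (simple i)))) ,
        -- Positivity of `m` places the origin strictly below the wall.
        <-respˡ (sym (pairing-origin (simple i))) (fromℕ-mono-< 0<m))
      where
      Kᵢ≡m = full-row⇒saturated eq

-- The bijection between regions and partitions.

module RowSumBijection (ℝ : RealNumbers) (n m : ℕ) where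

  open Catalan ℝ n m
  open Cells ℝ n m

  rowSums : DominantRegion → Partition n m
  rowSums R = record
    { part       = rowSum (address R)
    ; decreasing = rowSum-decreasing (witness R) (address-bounded R) (witness∈cell R)
    ; bounded    = λ i → ≡.subst (rowSum (address R) i ℕ.≤_) (ℕ.*-comm (n ℕ.∸ toℕ i) m) (rowSum-bounded (address-bounded R) i)
    }

  -- Equal regions share the witness of `R′`, and one point determines the address.
  rowSums-cong : ∀ {R R′} → points R ≐ points R′ → ∀ i → rowSum (address R) i ≡ rowSum (address R′) i
  rowSums-cong {R} {R′} (_ , R′⊆R) = rowSum-cong (address-of-point (witness R′) R (address-bounded R′)
    (R′⊆R {witness R′} (witness∈R R′)) (witness∈cell R′))

  rowSums-injective : ∀ {R R′} → (∀ i → rowSum (address R) i ≡ rowSum (address R′) i) → points R ≐ points R′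
  rowSums-injective {R} {R′} eq = region-≐ R R′ (address-determined (address-bounded R) (address-bounded R′)
    (witness R , witness∈cell R) (witness R′ , witness∈cell R′) eq)

  module _ (λₚ : Partition n m) where

    partition-configuration : Configuration m (part λₚ)
    partition-configuration = configuration m (decreasing λₚ _ _)
      (λ i → ≡.subst (part λₚ i ℕ.≤_) (ℕ.*-comm m (n ℕ.∸ toℕ i)) (bounded λₚ i))

    open Realisation ℝ n m partition-configuration

    realisingRegion : DominantRegion
    realisingRegion = cellRegion realised-bounded (point , point∈cell)

    -- The address of the region is tied to `realised` by uniqueness at the common point `point`.
    realisingRegion-rows : ∀ i → rowSum (address realisingRegion) i ≡ part λₚ i
    realisingRegion-rows i = ≡.trans
      (rowSum-cong (address-of-point point realisingRegion realised-bounded point∈cell point∈cell) i)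
      (realised-rows i)

  rowSumBijection : Bijection 𝓡 (𝓟 n m)
  rowSumBijection = record
    { to        = rowSums
    ; cong      = λ {R} {R′} → rowSums-cong {R} {R′}
    ; bijective = (λ {R} {R′} → rowSums-injective {R} {R′}) ,
        λ λₚ → realisingRegion λₚ , λ {R} R≈ i →
          ≡.trans (rowSums-cong {R} {realisingRegion λₚ} R≈ i) (realisingRegion-rows λₚ i)
    }

open import Data.Nat.Base using (NonZero; _∸_; _*_)

theorem1p3 : (ℝ : RealNumbers) (n m : ℕ) .{{_ : NonZero n}} .{{_ : NonZero m}} →
    let open Catalan ℝ n m in
    Σ[ φ ∈ Bijection 𝓡 (𝓟 n m) ]
    (∀ (i : Fin n) (R : DominantRegion) →
    IsSeparatingWall (simple i) m R ⇔ part (Bijection.to φ R) i ≡ (n ∸ toℕ i) * m)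
theorem1p3 ℝ n m = RowSumBijection.rowSumBijection ℝ n m , λ i R →
  mk⇔ (Wall.wall⇒full-row ℝ n m R i) (Wall.full-row⇒wall ℝ n m R i (ℕ.>-nonZero⁻¹ m))
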